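{- Every min-edge cut property is a Tutte cut property, and every min-edge cycle property is a Tutte cycle property.
   Context: Graphs are finite, undirected and connected; loops and multiple edges are allowed. A reference orientation $\mathcal{O}_{\mathrm{ref}}$ of $G$ assigns to each edge $e=\{u,v\}$ one of the ordered pairs $(u,v),(v,u)$. Every edge $e$ has two formal orientations $e^+$ and $e^-$ (treated as distinct even if $e$ is a loop): $e^+$ is directed as $\mathcal{O}_{\mathrm{ref}}(e)$ and $e^-$ is directed oppositely; $e^{\varepsilon}=(u,v)$ means $e^\varepsilon$ is directed from $u$ to $v$. Let $\mathbb{E}(G)=\{e^+,e^-: e\in E(G)\}$. An ordered, oriented graph is a triple $\mathbb{G}=(G,\mathcal{O}_{\mathrm{ref}},<)$ with $<$ a total order on $E(G)$. A fourientation of $\mathbb{G}$ is a subset $\mathcal{O}\subseteq\mathbb{E}(G)$; $e$ is oriented, unoriented, bioriented in $\mathcal{O}$ if exactly one, none, both of $e^+,e^-$ lie in $\mathcal{O}$. A cut is a partition $Cu=\{U,U^c\}$ of $V(G)$ into two nonempty parts, $E(Cu)$ is the set of edges with one endpoint in each part; it is simple if the induced subgraphs on $U$ and $U^c$ are connected. A directed cut is an ordered pair $\overrightarrow{Cu}=(U,U^c)$, with $E(\overrightarrow{Cu})=E(Cu)$; $\mathbb{E}(\overrightarrow{Cu})$ is the set of edge orientations directed from $U$ to $U^c$. A cycle is a cyclic list $v_1,e_1,\dots,v_k,e_k$ ($k\ge 1$) with distinct edges $e_i=\{v_i,v_{i+1}\}$ (indices mod $k$), up to rotation and reflection; it is simple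 if the $v_i$ are distinct. A directed cycle $\overrightarrow{Cy}=v_1,e_1^{\delta_1},\dots,v_k,e_k^{\delta_k}$ additionally has $e_i^{\delta_i}=(v_i,v_{i+1})$, up to rotation; $E(\overrightarrow{Cy})=\{e_i\}$, $\mathbb{E}(\overrightarrow{Cy})=\{e_i^{\delta_i}\}$. An isthmus is an edge $e$ with $E(Cu)=\{e\}$ for some cut; a loop is an edge joining a vertex to itself. $\overrightarrow{Cu}$ is a potential cut of $\mathcal{O}$ if $e^{\varepsilon}\in\mathbb{E}(\overrightarrow{Cu})$ implies $e^{ -\varepsilon}\notin\mathcal{O}$; $\overrightarrow{Cy}$ is a potential cycle of $\mathcal{O}$ if $\mathbb{E}(\overrightarrow{Cy})\subseteq\mathcal{O}$. $\mathbb{G}\setminus e$ and $\mathbb{G}/e$ denote deletion and contraction with induced reference orientation and order. A fourientation $\mathcal{O}$ of $\mathbb{G}\setminus e$ or $\mathbb{G}/e$ is also regarded as the fourientation of $\mathbb{G}$ in which $e$ is unoriented. For a simple cut $Cu$, $\mathbb{G}_{Cu}$ is obtained by contracting all edges not in $E(Cu)$; for a simple cycle $Cy$, $\mathbb{G}_{Cy}$ is obtained by deleting all edges not in $E(Cy)$ and removing isolated vertices; $\mathcal{O}_{C}$ is the fourientation of $\mathbb{G}_C$ induced by $\mathcal{O}$. A fourientation property is a map from pairs $(\mathbb{G},\mathcal{O})$ ($\mathcal{O}$ a fourientation of $\mathbb{G}$) to $\{\mathrm{good},\mathrm{bad}\}$, invariant under isomorphism (bijections of vertices and edges compatible with incidence,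 reference orientation, edge order and $\mathcal{O}$). It is a cut (cycle) property if $\mathcal{O}$ is good for $\mathbb{G}$ if and only if $\mathcal{O}_C$ is good for $\mathbb{G}_C$ for every simple cut (cycle) $C$. A cut (cycle) property is a Tutte cut (cycle) property if for all $\mathbb{G}$ (statements for cycle properties in parentheses): T1: $\mathcal{O}$ is bad for $\mathbb{G}$ only if $\mathcal{O}$ has a potential cut (cycle). T2: if the maximum edge $e$ of $\mathbb{G}$ is neither an isthmus nor a loop, then for every fourientation $\mathcal{O}$ of $\mathbb{G}\setminus e$ ($\mathbb{G}/e$): (a) if $\mathcal{O}$ is good for $\mathbb{G}\setminus e$ ($\mathbb{G}/e$), then $\mathcal{O}\cup\{e^+\}$ and $\mathcal{O}\cup\{e^-\}$ are both good for $\mathbb{G}$; (b) if $\mathcal{O}$ is bad for $\mathbb{G}\setminus e$ ($\mathbb{G}/e$) but $\mathcal{O}\cup\{e^+,e^-\}$ ($\mathcal{O}$) is good for $\mathbb{G}$, then exactly one of $\mathcal{O}\cup\{e^+\}$, $\mathcal{O}\cup\{e^-\}$ is good for $\mathbb{G}$; (c) $\mathcal{O}$ is good for $\mathbb{G}\setminus e$ ($\mathbb{G}/e$) if and only if $\mathcal{O}$ ($\mathcal{O}\cup\{e^+,e^-\}$) is good for $\mathbb{G}$. Min-edge properties. A min-edge cut (cycle) property is given by a set $X\subseteq\{\emptyset,\{ -\},\{+\}\}$ (for cycles, $X\subseteq\{\{ -\},\{+\},\{ -,+\}\}$) and $\delta\in\{+,-\}$. A potential cut (cycle) $\overrightarrow{C}$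 of a fourientation $\mathcal{O}$ of $\mathbb{G}$, with $e_{\min}$ the $<$-minimum edge of $E(\overrightarrow{C})$, is bad with respect to $(X,\delta)$ if both (i) $\{\varepsilon: e_{\min}^{\varepsilon}\in\mathcal{O}\}\in X$, and (ii) if $e_{\min}$ is unoriented (for cycles: bioriented) in $\mathcal{O}$ then $e_{\min}^{\delta}\in\mathbb{E}(\overrightarrow{C})$. Otherwise it is good. $\mathcal{O}$ is good with respect to the min-edge cut (cycle) property $(X,\delta)$ if and only if all of its potential cuts (cycles) are good. -}

module Defs where

open import Level using (0ℓ)
open import Data.Bool.Base using (Bool; true; false; not; _∧_; _∨_; _xor_)
import Data.Bool.Properties as Bool
open import Data.Empty using (⊥; ⊥-elim)
open import Data.Fin.Base using (Fin; zero; suc; inject₁)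
open import Data.Fin.Induction using (<-weakInduction)
import Data.Fin.Properties as Fin
open import Data.Fin.Relation.Unary.Top
  using (view; view-inject₁; ‵fromℕ; ‵inject₁)
open import Data.Irrelevant using ([_])
open import Data.List.Base using (List; []; _∷_)
open import Data.List.Membership.Propositional using (_∈_; lose; find)
open import Data.List.Relation.Unary.Any using (here; there; any?)
import Data.List.Relation.Unary.Any as Any
open import Data.Nat.Base using (ℕ; suc)
open import Data.Product.Base using (Σ; ∃-syntax; _×_; _,_; proj₁)
open import Data.Refinement using (Refinement; Refinement-syntax; value)
  renaming (_,_ to _⊣_)
open import Data.Sign.Base using (Sign; opposite)
import Data.Sign.Properties as Sign
open import Data.Sum.Base using (_⊎_; inj₁; inj₂)
open import Data.Unit.Base using (⊤; tt)
open import Function.Base using (_∘_; _on_)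
open import Function.Bundles using (_⇔_; _↔_; mk⇔; Inverse)
open import Relation.Binary.Bundles using (DecSetoid)
import Relation.Binary.Construct.On as On
open import Relation.Binary.Core using (Rel)
open import Relation.Binary.Definitions using (Trichotomous; tri<; tri≈; tri>)
open import Relation.Binary.PropositionalEquality
  using (_≡_; refl; cong; cong₂; subst; isEquivalence; resp₂; setoid)
open import Relation.Binary.Structures using (IsStrictTotalOrder)
open import Relation.Nullary using (¬_; Dec; does; yes; no; recompute)
open import Relation.Nullary.Decidable
  using (map′; _×-dec_; _⊎-dec_; dec-true; dec-false; does-⇔)
open import Relation.Unary using (Pred; Decidable)
open import Data.List.Relation.Unary.Enumerates.Setoid using (IsEnumeration)

------------------------------------------------------------------------
-- Ordered, oriented multigraphs

-- Vertices carry a decidable equivalence, so that a contraction can be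
-- formed by coarsening it.  The reference orientation directs each edge
-- from src to tgt.  Connectedness is imposed later, in OOGraph.

record Multigraph : Set₁ where
  infix 4 _<_
  field
    vertices           : DecSetoid 0ℓ 0ℓ
    E                  : Set
    _<_                : Rel E 0ℓ
    isStrictTotalOrder : IsStrictTotalOrder _≡_ _<_

  open DecSetoid vertices public
    using (_≈_)
    renaming (Carrier to V; _≟_ to _≈?_; setoid to vertexSetoid;
              refl to ≈-refl; sym to ≈-sym; trans to ≈-trans)
  open IsStrictTotalOrder isStrictTotalOrder public
    using (_≟_; compare)
    renaming (irrefl to <-irrefl; trans to <-trans)

  field
    src tgt         : E → V
    vertexList      : List V
    vertexList-full : IsEnumeration vertexSetoid vertexList
    edgeList        : List E
    edgeList-full   : IsEnumeration (setoid E) edgeList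

  -- e^ε is directed from tail e ε to head e ε.

  tail head : E → Sign → V
  tail e Sign.+ = src e
  tail e Sign.- = tgt e
  head e ε = tail e (opposite ε)

module _ (M : Multigraph) where
  open Multigraph M

  -- Walks all of whose edges lie in S.

  data Walk (S : Pred E 0ℓ) : V → V → Set where
    stay : ∀ {u v} → u ≈ v → Walk S u v
    step : ∀ {u v} e ε → S e → u ≈ tail e ε → Walk S (head e ε) v → Walk S u v

  AnyEdge : Pred E 0ℓ
  AnyEdge _ = ⊤

  record Connected : Set where
    field
      point : V
      walk  : ∀ u v → Walk AnyEdge u v

  IsLoop : Pred E 0ℓ
  IsLoop e = src e ≈ tgt e

  IsMaximum : Pred E 0ℓ
  IsMaximum e = ∀ f → f ≡ e ⊎ f < e

  IsMinimumOf : Pred E 0ℓ → Pred E 0ℓ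
  IsMinimumOf S e = S e × (∀ f → S f → f ≡ e ⊎ e < f)

  -- A fourientation is a subset of E × Sign, the set of all e^ε.

  Fourientation : Set
  Fourientation = E → Sign → Bool

------------------------------------------------------------------------
-- Walks

module _ {M : Multigraph} where
  open Multigraph M

  respˡ : ∀ {S u v w} → u ≈ v → Walk M S v w → Walk M S u w
  respˡ p (stay q)         = stay (≈-trans p q)
  respˡ p (step e ε s q w) = step e ε s (≈-trans p q) w

  _◅◅_ : ∀ {S u v w} → Walk M S u v → Walk M S v w → Walk M S u w
  stay p         ◅◅ w  = respˡ p w
  step e ε s p v ◅◅ w  = step e ε s p (v ◅◅ w)

  along : ∀ {S : Pred E 0ℓ} e ε → S e → Walk M S (tail e ε) (head e ε)
  along e ε s = step e ε s ≈-refl (stay ≈-refl)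

  back : ∀ {S : Pred E 0ℓ} e ε → S e → Walk M S (head e ε) (tail e ε)
  back e Sign.+ s = along e Sign.- s
  back e Sign.- s = along e Sign.+ s

  reverse : ∀ {S u v} → Walk M S u v → Walk M S v u
  reverse (stay p)         = stay (≈-sym p)
  reverse (step e ε s p w) = (reverse w ◅◅ back e ε s) ◅◅ stay (≈-sym p)

  weaken : ∀ {S T : Pred E 0ℓ} → (∀ {e} → S e → T e) → ∀ {u v} → Walk M S u v → Walk M T u v
  weaken f (stay p)         = stay p
  weaken f (step e ε s p w) = step e ε (f s) p (weaken f w)

  module _ {S : Pred E 0ℓ} (S? : Decidable S) where

    private
      In : List E → Pred E 0ℓ
      In es e = S e × e ∈ es

      Via : E → List E → V → V → Set
      Via e es u v = Walk M (In es) u (src e) × Walk M (In es) (tgt e) v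
                   ⊎ Walk M (In es) u (tgt e) × Walk M (In es) (src e) v

      grow : ∀ {e es u v} → Walk M (In es) u v → Walk M (In (e ∷ es)) u v
      grow = weaken λ (s , i) → s , there i

      join : ∀ {e es u v} → S e → Via e es u v → Walk M (In (e ∷ es)) u v
      join s (inj₁ (p , q)) = grow p ◅◅ (along _ Sign.+ (s , here refl) ◅◅ grow q)
      join s (inj₂ (p , q)) = grow p ◅◅ (along _ Sign.- (s , here refl) ◅◅ grow q)

      split : ∀ {e es u v} → Walk M (In (e ∷ es)) u v → Walk M (In es) u v ⊎ Via e es u v
      split (stay p) = inj₁ (stay p)
      split (step f ε (s , there i) p w) with split w
      ... | inj₁ w′               = inj₁ (step f ε (s , i) p w′)
      ... | inj₂ (inj₁ (w′ , w″)) = inj₂ (inj₁ (step f ε (s , i) p w′ , w″))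
      ... | inj₂ (inj₂ (w′ , w″)) = inj₂ (inj₂ (step f ε (s , i) p w′ , w″))
      split (step f Sign.+ (s , here refl) p w) with split w
      ... | inj₁ w′               = inj₂ (inj₁ (stay p , w′))
      ... | inj₂ (inj₁ (w′ , w″)) = inj₂ (inj₁ (stay p , w″))
      ... | inj₂ (inj₂ (w′ , w″)) = inj₁ (respˡ p w″)
      split (step f Sign.- (s , here refl) p w) with split w
      ... | inj₁ w′               = inj₂ (inj₂ (stay p , w′))
      ... | inj₂ (inj₁ (w′ , w″)) = inj₁ (respˡ p w″)
      ... | inj₂ (inj₂ (w′ , w″)) = inj₂ (inj₂ (stay p , w″))

      drop : ∀ {e es} → ¬ S e → ∀ {u v} → Walk M (In (e ∷ es)) u v → Walk M (In es) u v
      drop ¬s = weaken λ { (s , here refl) → ⊥-elim (¬s s) ; (s , there i) → s , i }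

      search : ∀ es u v → Dec (Walk M (In es) u v)
      search [] u v with u ≈? v
      ... | yes p = yes (stay p)
      ... | no ¬p = no λ { (stay p) → ¬p p ; (step _ _ (_ , ()) _ _) }
      search (e ∷ es) u v with S? e
      ... | no ¬s = map′ grow (drop ¬s) (search es u v)
      ... | yes s = map′ (λ { (inj₁ w) → grow w ; (inj₂ w) → join s w }) split
        (search es u v ⊎-dec
          ((search es u (src e) ×-dec search es (tgt e) v) ⊎-dec
           (search es u (tgt e) ×-dec search es (src e) v)))

    walk? : ∀ u v → Dec (Walk M S u v)
    walk? u v = map′ (weaken proj₁) (weaken λ s → s , edgeList-full _) (search edgeList u v)

------------------------------------------------------------------------
-- Deletion, contraction, removal of isolated vertices

module _ {A : Set} {P : Pred A 0ℓ} (P? : Decidable P) where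

  refineList : List A → List [ x ∈ A ∣ P x ]
  refineList []       = []
  refineList (x ∷ xs) with P? x
  ... | yes p = (x ⊣ [ p ]) ∷ refineList xs
  ... | no  _ = refineList xs

  refineList-∈ : ∀ {x xs} → x ∈ xs → (p : P x) → (x ⊣ [ p ]) ∈ refineList xs
  refineList-∈ {xs = x ∷ xs} i p with P? x | i
  ... | yes _ | here refl = here refl
  ... | yes _ | there j   = there (refineList-∈ j p)
  ... | no ¬p | here refl = ⊥-elim (¬p p)
  ... | no _  | there j   = refineList-∈ j p

module _ (M : Multigraph) where
  open Multigraph M

  -- The edges outside the set D.

  Outside : (E → Bool) → Set
  Outside D = [ e ∈ E ∣ D e ≡ false ]

  underlying : ∀ {D} → Outside D → E
  underlying = value

  private
    outside? : (D : E → Bool) → Decidable (λ (e : E) → D e ≡ false)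
    outside? D e = D e Bool.≟ false

  deleteEdges : (E → Bool) → Multigraph
  deleteEdges D = record
    { vertices           = vertices
    ; E                  = Outside D
    ; _<_                = _<_ on underlying
    ; isStrictTotalOrder = record
      { isStrictPartialOrder = record
        { isEquivalence = isEquivalence
        ; irrefl        = λ { refl → <-irrefl refl }
        ; trans         = <-trans
        ; <-resp-≈      = resp₂ (_<_ on underlying)
        }
      ; compare = compare′
      }
    ; src                = src ∘ underlying
    ; tgt                = tgt ∘ underlying
    ; vertexList         = vertexList
    ; vertexList-full    = vertexList-full
    ; edgeList           = refineList (outside? D) edgeList
    ; edgeList-full      = λ (e ⊣ [ p ]) →
        refineList-∈ (outside? D) (edgeList-full e) (recompute (outside? D e) p)
    }
    where
    compare′ : Trichotomous {A = Outside D} _≡_ (_<_ on underlying)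
    compare′ x y with compare (underlying x) (underlying y)
    ... | tri< a b c    = tri< a (b ∘ cong underlying) c
    ... | tri≈ a refl c = tri≈ a refl c
    ... | tri> a b c    = tri> a (b ∘ cong underlying) c

  -- Contracting C removes the edges of C and identifies the vertices
  -- joined by walks in C.

  contractEdges : (E → Bool) → Multigraph
  contractEdges C = record (deleteEdges C)
    { vertices = record
      { Carrier          = V
      ; _≈_              = Walk M InC
      ; isDecEquivalence = record
        { isEquivalence = record
          { refl = stay ≈-refl ; sym = reverse ; trans = _◅◅_ }
        ; _≟_ = walk? (λ e → C e Bool.≟ true)
        }
      }
    ; src             = src ∘ underlying
    ; tgt             = tgt ∘ underlying
    ; vertexList      = vertexList
    ; vertexList-full = Any.map stay ∘ vertexList-full
    }
    where
    InC : Pred E 0ℓ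
    InC e = C e ≡ true

  Incident : Pred V 0ℓ
  Incident v = ∃[ e ] (src e ≈ v ⊎ tgt e ≈ v)

  incident? : Decidable Incident
  incident? v = map′ (λ i → let e , _ , p = find i in e , p)
                     (λ (e , p) → lose (edgeList-full e) p)
                     (any? (λ e → (src e ≈? v) ⊎-dec (tgt e ≈? v)) edgeList)

  removeIsolated : Multigraph
  removeIsolated = record
    { vertices           = On.decSetoid vertices (value {P = Incident})
    ; E                  = E
    ; _<_                = _<_
    ; isStrictTotalOrder = isStrictTotalOrder
    ; src                = λ e → src e ⊣ [ e , inj₁ ≈-refl ]
    ; tgt                = λ e → tgt e ⊣ [ e , inj₂ ≈-refl ]
    ; vertexList         = refineList incident? vertexList
    ; vertexList-full    = full
    ; edgeList           = edgeList
    ; edgeList-full      = edgeList-full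
    }
    where
    Incident-resp : ∀ {u v} → u ≈ v → Incident u → Incident v
    Incident-resp p (e , inj₁ q) = e , inj₁ (≈-trans q p)
    Incident-resp p (e , inj₂ q) = e , inj₂ (≈-trans q p)

    full : IsEnumeration (DecSetoid.setoid (On.decSetoid vertices (value {P = Incident})))
                         (refineList incident? vertexList)
    full (v ⊣ [ p ]) =
      let x , x∈ , v≈x = find (vertexList-full v)
      in lose (refineList-∈ incident? x∈ (Incident-resp v≈x (recompute (incident? v) p))) v≈x

------------------------------------------------------------------------
-- Connected graphs, cuts and cycles

record OOGraph : Set₁ where
  field
    graph     : Multigraph
    connected : Connected graph
  open Multigraph graph public
  open Connected connected public

-- The cut {U , Uᶜ}, given by the indicator function of U.  All notions
-- for undirected cuts below are symmetric in the two parts; as a directed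
-- cut the same data stands for the ordered pair (U , Uᶜ).

record Cut (G : OOGraph) : Set where
  open OOGraph G
  field
    side      : V → Bool
    side-resp : ∀ {u v} → u ≈ v → side u ≡ side v
    nonempty  : ∀ b → ∃[ v ] side v ≡ b

  crosses : E → Bool
  crosses e = side (src e) xor side (tgt e)

  Edges : Pred E 0ℓ
  Edges e = crosses e ≡ true

  Directed : E → Sign → Set
  Directed e ε = side (tail e ε) ≡ true × side (head e ε) ≡ false

  Simple : Set
  Simple = ∀ b u v → side u ≡ b → side v ≡ b →
    Walk graph (λ e → side (src e) ≡ b × side (tgt e) ≡ b) u v

-- i + 1 modulo k + 1.

next : ∀ {k} → Fin (suc k) → Fin (suc k)
next i with view i
... | ‵fromℕ     = zero
... | ‵inject₁ j = suc j

-- A cyclic list with a chosen starting point and direction of traversal;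
-- nothing below depends on these choices.

record Cycle (G : OOGraph) : Set where
  open OOGraph G
  field
    {k-1}         : ℕ
    vertex        : Fin (suc k-1) → V
    edge          : Fin (suc k-1) → E
    edge-distinct : ∀ {i j} → edge i ≡ edge j → i ≡ j
    joins         : ∀ i → ∃[ ε ] (tail (edge i) ε ≈ vertex i × head (edge i) ε ≈ vertex (next i))

  Edges : Pred E 0ℓ
  Edges e = ∃[ i ] edge i ≡ e

  edges? : Decidable Edges
  edges? e = Fin.any? (λ i → edge i ≟ e)

  Simple : Set
  Simple = ∀ {i j} → vertex i ≈ vertex j → i ≡ j

record DirectedCycle (G : OOGraph) : Set where
  open OOGraph G
  field
    cycle : Cycle G
  open Cycle cycle public
  field
    sign     : Fin (suc k-1) → Sign
    directed : ∀ i → tail (edge i) (sign i) ≈ vertex i × head (edge i) (sign i) ≈ vertex (next i)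

  Directed : E → Sign → Set
  Directed e ε = ∃[ i ] (edge i ≡ e × sign i ≡ ε)

IsIsthmus : (G : OOGraph) → OOGraph.E G → Set
IsIsthmus G e = Σ (Cut G) λ Cu → ∀ f → Cut.Edges Cu f ⇔ f ≡ e

------------------------------------------------------------------------
-- G ∖ e, G / e, G_Cu and G_Cy

module _ (G : OOGraph) where
  open OOGraph G

  only : E → E → Bool
  only e f = does (f ≟ e)

  private
    only-false : ∀ {e f} → ¬ (f ≡ e) → only e f ≡ false
    only-false {e} {f} = dec-false (f ≟ e)

    lower : ∀ {D u v} → Walk graph (λ e → D e ≡ false) u v →
            Walk (deleteEdges graph D) (AnyEdge (deleteEdges graph D)) u v
    lower (stay p)              = stay p
    lower (step e Sign.+ s p w) = step (e ⊣ [ s ]) Sign.+ tt p (lower w)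
    lower (step e Sign.- s p w) = step (e ⊣ [ s ]) Sign.- tt p (lower w)

    contracted : ∀ {C u v} → Walk graph (AnyEdge graph) u v →
                 Walk (contractEdges graph C) (AnyEdge (contractEdges graph C)) u v
    contracted (stay p) = stay (stay p)
    contracted {C} (step e ε s p w) with C e in eq | ε
    ... | true  | Sign.+ = respˡ (step e Sign.+ eq p (stay ≈-refl)) (contracted w)
    ... | true  | Sign.- = respˡ (step e Sign.- eq p (stay ≈-refl)) (contracted w)
    ... | false | Sign.+ = step (e ⊣ [ eq ]) Sign.+ tt (stay p) (contracted w)
    ... | false | Sign.- = step (e ⊣ [ eq ]) Sign.- tt (stay p) (contracted w)

    separated : ∀ {A B : Set} (a? : Dec A) (b? : Dec B) →
                does a? xor does b? ≡ true → (A → B) → (B → A) → ⊥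
    separated (yes a) (no ¬b) _ f g = ¬b (f a)
    separated (no ¬a) (yes b) _ f g = ¬a (g b)

    module _ {e} (¬isthmus : ¬ IsIsthmus G e) where

      Others : Pred E 0ℓ
      Others f = only e f ≡ false

      others? : ∀ u v → Dec (Walk graph Others u v)
      others? = walk? (λ f → only e f Bool.≟ false)

      component : ¬ Walk graph Others (src e) (tgt e) → Cut G
      component ¬w = record
        { side      = λ v → does (others? (src e) v)
        ; side-resp = λ p → does-⇔ (mk⇔ (_◅◅ stay p) (_◅◅ stay (≈-sym p)))
                                   (others? _ _) (others? _ _)
        ; nonempty  = λ { true  → src e , dec-true (others? _ _) (stay ≈-refl)
                        ; false → tgt e , dec-false (others? _ _) ¬w }
        }

      bridged : Walk graph Others (src e) (tgt e)
      bridged with others? (src e) (tgt e)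
      ... | yes w = w
      ... | no ¬w = ⊥-elim (¬isthmus (component ¬w , λ f → mk⇔ (to f) λ { refl → from }))
        where
        open Cut (component ¬w)

        from : Edges e
        from = cong₂ _xor_ (dec-true (others? (src e) (src e)) (stay ≈-refl))
                           (dec-false (others? (src e) (tgt e)) ¬w)

        to : ∀ f → Edges f → f ≡ e
        to f c with f ≟ e
        ... | yes p = p
        ... | no ¬p = ⊥-elim (separated (others? _ _) (others? _ _) c
                               (_◅◅ along f Sign.+ (only-false ¬p))
                               (_◅◅ along f Sign.- (only-false ¬p)))

      reroute : ∀ {u v} → Walk graph (AnyEdge graph) u v → Walk graph Others u v
      reroute (stay p) = stay p
      reroute (step f ε s p w) with f ≟ e | ε
      ... | no ¬p    | ε′     = step f ε′ (only-false ¬p) p (reroute w)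
      ... | yes refl | Sign.+ = respˡ p (bridged ◅◅ reroute w)
      ... | yes refl | Sign.- = respˡ p (reverse bridged ◅◅ reroute w)

  -- Only an edge that is not an isthmus can be deleted, as graphs are
  -- connected.

  delete : (e : E) → ¬ IsIsthmus G e → OOGraph
  delete e ¬isthmus = record
    { graph     = deleteEdges graph (only e)
    ; connected = record
      { point = point ; walk = λ u v → lower (reroute ¬isthmus (walk u v)) }
    }

  contractAll : (E → Bool) → OOGraph
  contractAll C = record
    { graph     = contractEdges graph C
    ; connected = record
      { point = point ; walk = λ u v → contracted (walk u v) }
    }

  contract : E → OOGraph
  contract e = contractAll (only e)

  offCut : Cut G → E → Bool
  offCut Cu e = not (Cut.crosses Cu e)

  cutMinor : Cut G → OOGraph
  cutMinor Cu = contractAll (offCut Cu)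

  offCycle : Cycle G → E → Bool
  offCycle Cy e = not (does (Cycle.edges? Cy e))

  private
    module _ (Cy : Cycle G) where
      open Cycle Cy

      held : ∀ {A : Set} (a? : Dec A) → not (does a?) ≡ false → A
      held (yes a) _ = a

      H : Multigraph
      H = deleteEdges graph (offCycle Cy)

      on : ∀ i → offCycle Cy (edge i) ≡ false
      on i = cong not (dec-true (edges? (edge i)) (i , refl))

      e[_] : Fin (suc k-1) → Multigraph.E H
      e[ i ] = edge i ⊣ [ on i ]

      at : ∀ i → Incident H (vertex i)
      at i with joins i
      ... | Sign.+ , p , _ = e[ i ] , inj₁ p
      ... | Sign.- , p , _ = e[ i ] , inj₂ p

      v[_] : Fin (suc k-1) → Multigraph.V (removeIsolated H)
      v[ i ] = vertex i ⊣ [ at i ]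

      W : Rel (Multigraph.V (removeIsolated H)) 0ℓ
      W = Walk (removeIsolated H) (AnyEdge (removeIsolated H))

      edgeWalk : ∀ i → W v[ i ] v[ next i ]
      edgeWalk i with joins i
      ... | Sign.+ , p , q = step e[ i ] Sign.+ tt (≈-sym p) (stay q)
      ... | Sign.- , p , q = step e[ i ] Sign.- tt (≈-sym p) (stay q)

      next-inject₁ : (i : Fin k-1) → next (inject₁ i) ≡ suc i
      next-inject₁ i rewrite view-inject₁ i = refl

      fromZero : ∀ i → W v[ zero ] v[ i ]
      fromZero = <-weakInduction (λ i → W v[ zero ] v[ i ]) (stay ≈-refl)
        λ i w → w ◅◅ subst (λ j → W v[ inject₁ i ] v[ j ]) (next-inject₁ i) (edgeWalk (inject₁ i))

      onCycle : ∀ {v} → Incident H v → ∃[ i ] vertex i ≈ v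
      onCycle ((e ⊣ [ p ]) , q) with held (edges? e) (recompute (offCycle Cy e Bool.≟ false) p)
      ... | i , refl with joins i | q
      ...   | Sign.+ , a , b | inj₁ c = i , ≈-trans (≈-sym a) c
      ...   | Sign.+ , a , b | inj₂ c = next i , ≈-trans (≈-sym b) c
      ...   | Sign.- , a , b | inj₁ c = next i , ≈-trans (≈-sym b) c
      ...   | Sign.- , a , b | inj₂ c = i , ≈-trans (≈-sym a) c

      cycleWalk : ∀ u v → W u v
      cycleWalk (u ⊣ [ p ]) (v ⊣ [ q ]) =
        let i , a = onCycle (recompute (incident? H u) p)
            j , b = onCycle (recompute (incident? H v) q)
        in respˡ (≈-sym a) (reverse (fromZero i) ◅◅ (fromZero j ◅◅ stay b))

  cycleMinor : Cycle G → OOGraph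
  cycleMinor Cy = record
    { graph     = removeIsolated (deleteEdges graph (offCycle Cy))
    ; connected = record { point = v[_] Cy zero ; walk = cycleWalk Cy }
    }

------------------------------------------------------------------------
-- Fourientations

module _ (G : OOGraph) where
  open OOGraph G

  𝔽 : Set
  𝔽 = Fourientation graph

  restrict : ∀ {D} → 𝔽 → Outside graph D → Sign → Bool
  restrict O e ε = O (value e) ε

  -- A fourientation of a minor, regarded as one of G in which the edges
  -- of D are unoriented.

  extend : ∀ {D} → (Outside graph D → Sign → Bool) → 𝔽
  extend {D} O e ε with D e Bool.≟ false
  ... | yes p = O (e ⊣ [ p ]) ε
  ... | no _  = false

  -- O ∪ {e^ε}

  add : 𝔽 → E → Sign → 𝔽
  add O e ε f φ = O f φ ∨ (only G e f ∧ does (φ Sign.≟ ε))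

  Unoriented Bioriented : 𝔽 → E → Set
  Unoriented O e = ∀ ε → O e ε ≡ false
  Bioriented O e = ∀ ε → O e ε ≡ true

  PotentialCut : 𝔽 → Cut G → Set
  PotentialCut O Cu = ∀ e ε → Cut.Directed Cu e ε → O e (opposite ε) ≡ false

  PotentialCycle : 𝔽 → DirectedCycle G → Set
  PotentialCycle O Cy = ∀ e ε → DirectedCycle.Directed Cy e ε → O e ε ≡ true

record Isomorphism (G : OOGraph) (O : 𝔽 G) (H : OOGraph) (O′ : 𝔽 H) : Set where
  private
    module G = OOGraph G
    module H = OOGraph H
  field
    onV : Inverse G.vertexSetoid H.vertexSetoid
    onE : G.E ↔ H.E
  vmap = Inverse.to onV
  emap = Inverse.to onE
  field
    src-compat   : ∀ e → vmap (G.src e) H.≈ H.src (emap e)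
    tgt-compat   : ∀ e → vmap (G.tgt e) H.≈ H.tgt (emap e)
    order-compat : ∀ e f → e G.< f ⇔ emap e H.< emap f
    O-compat     : ∀ e ε → O e ε ≡ O′ (emap e) ε

------------------------------------------------------------------------
-- Fourientation properties

-- The map to {good , bad} is given by the predicate "is good", which
-- IsFourientationProperty requires to be decidable.

FProperty : Set₁
FProperty = (G : OOGraph) → 𝔽 G → Set

record IsFourientationProperty (P : FProperty) : Set₁ where
  field
    good?     : ∀ G O → Dec (P G O)
    invariant : ∀ {G O H O′} → Isomorphism G O H O′ → P G O ⇔ P H O′

ExactlyOne : Set → Set → Set
ExactlyOne A B = (A × ¬ B) ⊎ (¬ A × B)

IsCutProperty : FProperty → Set₁
IsCutProperty P = ∀ G O →
  P G O ⇔ (∀ Cu → Cut.Simple Cu → P (cutMinor G Cu) (restrict G O))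

IsCycleProperty : FProperty → Set₁
IsCycleProperty P = ∀ G O →
  P G O ⇔ (∀ Cy → Cycle.Simple Cy → P (cycleMinor G Cy) (restrict G O))

module _ (P : FProperty) (G : OOGraph) where
  open OOGraph G

  record CutT2 (e : E) (¬isthmus : ¬ IsIsthmus G e) (O : 𝔽 (delete G e ¬isthmus)) : Set where
    O₀ = extend G O
    O₊ = add G O₀ e Sign.+
    O₋ = add G O₀ e Sign.-
    O± = add G O₊ e Sign.-
    field
      a : P (delete G e ¬isthmus) O → P G O₊ × P G O₋
      b : ¬ P (delete G e ¬isthmus) O → P G O± → ExactlyOne (P G O₊) (P G O₋)
      c : P (delete G e ¬isthmus) O ⇔ P G O₀

  record CycleT2 (e : E) (O : 𝔽 (contract G e)) : Set where
    O₀ = extend G O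
    O₊ = add G O₀ e Sign.+
    O₋ = add G O₀ e Sign.-
    O± = add G O₊ e Sign.-
    field
      a : P (contract G e) O → P G O₊ × P G O₋
      b : ¬ P (contract G e) O → P G O₀ → ExactlyOne (P G O₊) (P G O₋)
      c : P (contract G e) O ⇔ P G O±

record IsTutteCutProperty (P : FProperty) : Set₁ where
  field
    isFourientationProperty : IsFourientationProperty P
    isCutProperty           : IsCutProperty P
    T1 : ∀ G O → ¬ P G O → ∃[ Cu ] PotentialCut G O Cu
    T2 : ∀ G e → IsMaximum (OOGraph.graph G) e →
         (¬isthmus : ¬ IsIsthmus G e) → ¬ IsLoop (OOGraph.graph G) e →
         ∀ O → CutT2 P G e ¬isthmus O

record IsTutteCycleProperty (P : FProperty) : Set₁ where
  field
    isFourientationProperty : IsFourientationProperty P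
    isCycleProperty         : IsCycleProperty P
    T1 : ∀ G O → ¬ P G O → ∃[ Cy ] PotentialCycle G O Cy
    T2 : ∀ G e → IsMaximum (OOGraph.graph G) e →
         ¬ IsIsthmus G e → ¬ IsLoop (OOGraph.graph G) e →
         ∀ O → CycleT2 P G e O

------------------------------------------------------------------------
-- Min-edge properties

-- A subset of {+ , -}, as the truth values of "+ belongs" and
-- "- belongs".

SignSet : Set
SignSet = Bool × Bool

record MinEdgeCutDatum : Set where
  field
    X      : SignSet → Bool
    X-cut  : X (true , true) ≡ false
    δ      : Sign

record MinEdgeCycleDatum : Set where
  field
    X       : SignSet → Bool
    X-cycle : X (false , false) ≡ false
    δ       : Sign

orientations : (G : OOGraph) → 𝔽 G → OOGraph.E G → SignSet
orientations G O e = O e Sign.+ , O e Sign.-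

module _ (datum : MinEdgeCutDatum) where
  open MinEdgeCutDatum datum

  BadCut : (G : OOGraph) → 𝔽 G → Cut G → Set
  BadCut G O Cu = ∃[ m ]
    ( IsMinimumOf (OOGraph.graph G) (Cut.Edges Cu) m
    × X (orientations G O m) ≡ true
    × (Unoriented G O m → Cut.Directed Cu m δ))

  minEdgeCut : FProperty
  minEdgeCut G O = ∀ Cu → PotentialCut G O Cu → ¬ BadCut G O Cu

module _ (datum : MinEdgeCycleDatum) where
  open MinEdgeCycleDatum datum

  BadCycle : (G : OOGraph) → 𝔽 G → DirectedCycle G → Set
  BadCycle G O Cy = ∃[ m ]
    ( IsMinimumOf (OOGraph.graph G) (DirectedCycle.Edges Cy) m
    × X (orientations G O m) ≡ true
    × (Bioriented G O m → DirectedCycle.Directed Cy m δ))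

  minEdgeCycle : FProperty
  minEdgeCycle G O = ∀ Cy → PotentialCycle G O Cy → ¬ BadCycle G O Cy

{-# OPTIONS --safe #-}

-- A bad potential cut with minimum edge m = e_min passes m in a direction m^ε
-- determined by O at m, and one exists if and only if the head of m^ε cannot
-- reach its tail along arcs of O and edges below m; it can then be chosen
-- simple.  Dually, a bad potential cycle exists if and only if the head of such
-- an m^ε reaches its tail along arcs of O above m; it is simple after loop
-- erasure.
--
-- In T2 the maximum edge e causes no obstruction itself, and it enters the
-- other reachability questions only through the arcs e^+, e^- that O contains.
-- A route need not use both of these, and routes through e^+ and e^- for two
-- edges m, m′ combine to one that avoids e, as the arc of the one edge is
-- available to the routes of the other.  This decides which of O ∪ {e^+},
-- O ∪ {e^-} are good.

module Submission where

open import Defs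
open import Level using (0ℓ)
open import Data.Bool.Base using (Bool; true; false; not; _xor_)
import Data.Bool.Properties as Bool
open import Data.Empty using (⊥; ⊥-elim)
open import Data.Fin.Base using (Fin; zero; suc; inject₁; fromℕ)
open import Data.Fin.Induction using (<-weakInduction; >-weakInduction)
import Data.Fin.Properties as Fin
open import Data.Fin.Relation.Unary.Top
  using (view; view-inject₁; view-fromℕ; ‵fromℕ; ‵inject₁)
open import Data.Irrelevant using ([_])
open import Data.List.Base using (List; []; _∷_; length; lookup; cartesianProduct)
open import Data.List.Membership.Propositional using (_∈_; lose; find)
open import Data.List.Membership.Propositional.Properties using (∈-cartesianProduct⁺; ∈-lookup)
open import Data.List.Relation.Unary.All as All using (All; []; _∷_)
open import Data.List.Relation.Unary.AllPairs using (AllPairs; []; _∷_)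
open import Data.List.Relation.Unary.Any using (here; there; any?)
open import Data.Nat.Base using (suc)
open import Data.Product.Base using (Σ; ∃-syntax; _×_; _,_; proj₁; proj₂; uncurry)
open import Data.Refinement using (value) renaming (_,_ to _⊣_)
open import Data.Sign.Base using (Sign; opposite)
import Data.Sign.Properties as Sign
open import Data.Sum.Base using (_⊎_; inj₁; inj₂; [_,_]′)
open import Data.Unit.Base using (⊤; tt)
open import Function.Base using (_∘_; id)
open import Function.Bundles using (_⇔_; mk⇔; Inverse; Equivalence)
open import Function.Construct.Symmetry using (inverse; ↔-sym)
open import Relation.Binary.Definitions using (tri<; tri≈; tri>)
open import Relation.Binary.PropositionalEquality
  using (_≡_; _≢_; _≗_; refl; sym; trans; cong; cong₂; subst; subst₂)
open import Relation.Binary.Structures using (IsStrictTotalOrder)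
open import Relation.Nullary using (¬_; Dec; does; yes; no; recompute)
open import Relation.Nullary.Decidable
  using (map′; _×-dec_; _⊎-dec_; _→-dec_; ¬?; dec-true; dec-false; does-⇔; decidable-stable)
open import Relation.Unary using (Pred; Decidable)

-- Routes along directed arcs: decidability, and rerouting around one edge

signs : List Sign
signs = Sign.+ ∷ Sign.- ∷ []

∈-signs : ∀ ε → ε ∈ signs
∈-signs Sign.+ = here refl
∈-signs Sign.- = there (here refl)

∀-sign? : {Q : Sign → Set} → (∀ ε → Dec (Q ε)) → Dec (∀ ε → Q ε)
∀-sign? Q? = map′ (λ { (q₊ , q₋) Sign.+ → q₊ ; (q₊ , q₋) Sign.- → q₋ })
                  (λ q → q Sign.+ , q Sign.-)
                  (Q? Sign.+ ×-dec Q? Sign.-)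

Arcs : Multigraph → Set₁
Arcs M = Multigraph.E M → Sign → Set

module _ (M : Multigraph) where
  open Multigraph M

  data Route (A : Arcs M) : V → V → Set where
    stay : ∀ {u v} → u ≈ v → Route A u v
    step : ∀ {u v} e ε → A e ε → u ≈ tail e ε → Route A (head e ε) v → Route A u v

  -- Taking for `S` the empty set, one sign, or all signs covers the four ways to orient `e` in T2.
  adjoin : Arcs M → E → (Sign → Set) → Arcs M
  adjoin A e S f φ = A f φ ⊎ (f ≡ e × S φ)

module _ {M : Multigraph} where
  open Multigraph M

  infix 4 _⊆_
  _⊆_ : Arcs M → Arcs M → Set
  A ⊆ B = ∀ {f φ} → A f φ → B f φ

  arcList : List (E × Sign)
  arcList = cartesianProduct edgeList signs

  ∈-arcList : ∀ e ε → (e , ε) ∈ arcList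
  ∈-arcList e ε = ∈-cartesianProduct⁺ (edgeList-full e) (∈-signs ε)

  ∃-arc? : {Q : Arcs M} → (∀ e ε → Dec (Q e ε)) → Dec (∃[ e ] ∃[ ε ] Q e ε)
  ∃-arc? {Q} Q? = map′ (λ i → let (e , ε) , _ , q = find {P = uncurry Q} i in e , ε , q)
                       (λ (e , ε , q) → lose {P = uncurry Q} (∈-arcList e ε) q)
                       (any? (uncurry Q?) arcList)

  ≈-reflexive : ∀ {u v} → u ≡ v → u ≈ v
  ≈-reflexive refl = ≈-refl

  head-opposite : ∀ e ε → head e (opposite ε) ≡ tail e ε
  head-opposite e ε = cong (tail e) (Sign.opposite-involutive ε)

  -- Reachability is the least preorder that contains `_≈_` and the arcs. This serves both to carry
  -- routes from one graph to another and to propagate an invariant along a route.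
  fold : ∀ {A} (_∼_ : V → V → Set) →
         (∀ {u v} → u ≈ v → u ∼ v) →
         (∀ {u v w} → u ∼ v → v ∼ w → u ∼ w) →
         (∀ e ε → A e ε → tail e ε ∼ head e ε) →
         ∀ {u v} → Route M A u v → u ∼ v
  fold _∼_ ≈⇒∼ tr arc (stay p)         = ≈⇒∼ p
  fold _∼_ ≈⇒∼ tr arc (step e ε a p r) =
    tr (≈⇒∼ p) (tr (arc e ε a) (fold _∼_ ≈⇒∼ tr arc r))

  prepend : ∀ {A u v w} → u ≈ v → Route M A v w → Route M A u w
  prepend p (stay q)         = stay (≈-trans p q)
  prepend p (step e ε a q r) = step e ε a (≈-trans p q) r

  infixr 5 _▷_
  _▷_ : ∀ {A u v w} → Route M A u v → Route M A v w → Route M A u w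
  stay p         ▷ s = prepend p s
  step e ε a p r ▷ s = step e ε a p (r ▷ s)

  arc : ∀ {A : Arcs M} e ε → A e ε → Route M A (tail e ε) (head e ε)
  arc e ε a = step e ε a ≈-refl (stay ≈-refl)

  mono : ∀ {A B} → A ⊆ B → ∀ {u v} → Route M A u v → Route M B u v
  mono A⊆B = fold (Route M _) stay _▷_ (λ e ε a → arc e ε (A⊆B a))

  along-edges : ∀ {S : Pred E 0ℓ} {A : Arcs M} → (∀ {e} → S e → ∀ ε → A e ε) →
                ∀ {u v} → Walk M S u v → Route M A u v
  along-edges f (stay p)         = stay p
  along-edges f (step e ε s p w) = step e ε (f s ε) p (along-edges f w)

  -- A route that uses the arc e^ε may be cut before its first and after its
  -- last use.
  split : ∀ {A B : Arcs M} {e ε} → (∀ {f φ} → B f φ → A f φ ⊎ (f ≡ e × φ ≡ ε)) →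
          ∀ {u v} → Route M B u v →
          Route M A u v ⊎ (Route M A u (tail e ε) × Route M A (head e ε) v)
  split new (stay p) = inj₁ (stay p)
  split new (step f φ b p r) with new b | split new r
  ... | inj₁ a             | inj₁ s       = inj₁ (step f φ a p s)
  ... | inj₁ a             | inj₂ (s , t) = inj₂ (step f φ a p s , t)
  ... | inj₂ (refl , refl) | inj₁ s       = inj₂ (stay p , s)
  ... | inj₂ (refl , refl) | inj₂ (s , t) = inj₂ (stay p , t)

  module _ {A : Arcs M} (A? : ∀ e ε → Dec (A e ε)) where

    private
      In : List (E × Sign) → Arcs M
      In as e ε = A e ε × (e , ε) ∈ as

      -- Induction on the list of usable arcs: by `split`, a route through the first arc amounts to
      -- two routes without it.
      search : ∀ as u v → Dec (Route M (In as) u v)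
      search [] u v = map′ stay (λ { (stay p) → p ; (step _ _ (_ , ()) _ _) }) (u ≈? v)
      search ((e , ε) ∷ as) u v with A? e ε
      ... | no ¬a = map′ (mono (λ (a , i) → a , there i))
                         (mono (λ { (a , here refl) → ⊥-elim (¬a a) ; (a , there i) → a , i }))
                         (search as u v)
      ... | yes a = map′ from
                         (split λ { (a , here refl) → inj₂ (refl , refl)
                                  ; (a , there i)   → inj₁ (a , i) })
                         (search as u v ⊎-dec (search as u (tail e ε) ×-dec search as (head e ε) v))
        where
        grow : In as ⊆ In ((e , ε) ∷ as)
        grow (a , i) = a , there i

        from : Route M (In as) u v ⊎ (Route M (In as) u (tail e ε) × Route M (In as) (head e ε) v) →
               Route M (In ((e , ε) ∷ as)) u v
        from (inj₁ r)       = mono grow r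
        from (inj₂ (r , s)) = mono grow r ▷ step e ε (a , here refl) ≈-refl (mono grow s)

    route? : ∀ u v → Dec (Route M A u v)
    route? u v = map′ (mono proj₁) (mono λ a → a , ∈-arcList _ _) (search arcList u v)

  module _ {e : E} where

    private
      infixl 6 _+ₑ_
      _+ₑ_ : Arcs M → (Sign → Set) → Arcs M
      A +ₑ S = adjoin M A e S

    -- If both routes use `e`, the first reaches `src e`, the tail of `e^+`, without it, and the
    -- second continues from `src e`, the head of `e^-`, without it.
    both-signs-needless : ∀ {A : Arcs M} {u v} → Route M (A +ₑ (_≡ Sign.+)) u v →
                          Route M (A +ₑ (_≡ Sign.-)) u v → Route M A u v
    both-signs-needless r₊ r₋ with split {e = e} {ε = Sign.+} id r₊ | split {e = e} {ε = Sign.-} id r₋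
    ... | inj₁ r       | _            = r
    ... | inj₂ _       | inj₁ r       = r
    ... | inj₂ (r , _) | inj₂ (_ , s) = r ▷ s

    -- The tail of each of `e^+`, `e^-` is the head of the other, so a route that uses both meets an
    -- end of `e` twice, and the detour in between can be cut out.
    one-sign-suffices : ∀ {A : Arcs M} {u v} → Route M (A +ₑ (λ _ → ⊤)) u v →
                        Route M (A +ₑ (_≡ Sign.+)) u v ⊎ Route M (A +ₑ (_≡ Sign.-)) u v
    one-sign-suffices {A} r with split {A = A +ₑ (_≡ Sign.+)} {e = e} {ε = Sign.-} (λ
        { (inj₁ a) → inj₁ (inj₁ a)
        ; {φ = Sign.+} (inj₂ (p , _)) → inj₁ (inj₂ (p , refl))
        ; {φ = Sign.-} (inj₂ (p , _)) → inj₂ (p , refl) }) r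
    ... | inj₁ s = inj₁ s
    ... | inj₂ (s , t) with split {e = e} {ε = Sign.+} id s | split {e = e} {ε = Sign.+} id t
    ...   | inj₂ (a , _) | _            = inj₁ (mono inj₁ a ▷ t)
    ...   | inj₁ a       | inj₁ b       =
      inj₂ (mono inj₁ a ▷ step e Sign.- (inj₂ (refl , refl)) ≈-refl (mono inj₁ b))
    ...   | inj₁ a       | inj₂ (_ , b) = inj₁ (mono inj₁ (a ▷ b))

    -- The routes u → e^ε → v and u′ → e^-ε → v′, joined by v → u, combine to
    -- a route from u′ to v′ that avoids e.
    uncross : ∀ {A B : Arcs M} ε {u v u′ v′} → A ⊆ B → Route M B v u →
              Route M (A +ₑ (_≡ ε)) u v → Route M (B +ₑ (_≡ opposite ε)) u′ v′ →
              Route M A u v ⊎ Route M B u′ v′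
    uncross ε A⊆B back r r′ with split {e = e} {ε = ε} id r | split {e = e} {ε = opposite ε} id r′
    ... | inj₁ s       | _              = inj₁ s
    ... | inj₂ _       | inj₁ s         = inj₂ s
    ... | inj₂ (s , t) | inj₂ (s′ , t′) = inj₂
      -- `s′` ends at the tail of `e^-ε`, which is the head of `e^ε`, where `t` starts; `s` ends at
      -- the tail of `e^ε`, where `t′` starts.
      (s′ ▷ mono A⊆B t ▷ back ▷ mono A⊆B s ▷ prepend (≈-reflexive (sym (head-opposite e ε))) t′)

exactly-one : ∀ {A B : Set} → Dec A → Dec B → ¬ (A × B) → ¬ (¬ A × ¬ B) → ExactlyOne A B
exactly-one (yes a) (yes b) ¬both ¬none = ⊥-elim (¬both (a , b))
exactly-one (yes a) (no ¬b) ¬both ¬none = inj₁ (a , ¬b)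
exactly-one (no ¬a) (yes b) ¬both ¬none = inj₂ (¬a , b)
exactly-one (no ¬a) (no ¬b) ¬both ¬none = ⊥-elim (¬none (¬a , ¬b))

-- Isomorphisms

module IsomorphismProperties {G : OOGraph} {O : 𝔽 G} {H : OOGraph} {O′ : 𝔽 H}
                             (iso : Isomorphism G O H O′) where
  private
    module G = OOGraph G
    module H = OOGraph H
  open Isomorphism iso
  open Inverse onE using () renaming
    (from to emap⁻¹; strictlyInverseˡ to emap-emap⁻¹)

  tail-compat : ∀ e ε → vmap (G.tail e ε) H.≈ H.tail (emap e) ε
  tail-compat e Sign.+ = src-compat e
  tail-compat e Sign.- = tgt-compat e

  route-map : ∀ {A : Arcs G.graph} {B : Arcs H.graph} → (∀ {e ε} → A e ε → B (emap e) ε) →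
              ∀ {u v} → Route G.graph A u v → Route H.graph B (vmap u) (vmap v)
  route-map A⇒B = fold (λ u v → Route H.graph _ (vmap u) (vmap v))
    (λ p → stay (Inverse.to-cong onV p)) _▷_
    (λ e ε a → prepend (tail-compat e ε) (arc (emap e) ε (A⇒B a))
               ▷ stay (H.≈-sym (tail-compat e (opposite ε))))

  -- With this, invariance of a property needs only one of the two implications.
  inverse-iso : Isomorphism H O′ G O
  inverse-iso = record
    { onV          = inverse onV
    ; onE          = ↔-sym onE
    ; src-compat   = λ e → Inverse.inverseʳ onV (H.≈-sym
        (subst (λ f → _ H.≈ H.src f) (emap-emap⁻¹ e) (src-compat (emap⁻¹ e))))
    ; tgt-compat   = λ e → Inverse.inverseʳ onV (H.≈-sym
        (subst (λ f → _ H.≈ H.tgt f) (emap-emap⁻¹ e) (tgt-compat (emap⁻¹ e))))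
    ; order-compat = λ e f → let open Equivalence (order-compat (emap⁻¹ e) (emap⁻¹ f)) in
        mk⇔ (λ p → from (subst id (sym (cong₂ H._<_ (emap-emap⁻¹ e) (emap-emap⁻¹ f))) p))
            (λ p → subst id (cong₂ H._<_ (emap-emap⁻¹ e) (emap-emap⁻¹ f)) (to p))
    ; O-compat     = λ e ε → trans (cong (λ f → O′ f ε) (sym (emap-emap⁻¹ e)))
                                   (sym (O-compat (emap⁻¹ e) ε))
    }

-- Return routes and the two orientations of one edge

-- The potential cuts (cycles) that T2 is about are encoded by the arcs in T:
-- the arc m^ε stands for those in which m^ε lies and m is the minimum edge, and
-- these exist according to whether R m leads from the head of m^ε to its tail.
module _ (M : Multigraph) (e : Multigraph.E M) (T : Arcs M) (R : Multigraph.E M → Arcs M) where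
  open Multigraph M

  Returns : (Sign → Set) → Arcs M
  Returns S m ε = Route M (adjoin M (R m) e S) (head m ε) (tail m ε)

  -- A bad cycle is closed up by a return route, a bad cut exists where there is none: `Linked`
  -- serves cycles, `Blocked` cuts.
  Linked Blocked : (Sign → Set) → Set
  Linked  S = ∃[ m ] ∃[ ε ] (T m ε × Returns S m ε)
  Blocked S = ∃[ m ] ∃[ ε ] (T m ε × ¬ Returns S m ε)

  -- For cuts this will hold when `m < m′`, since `Below` grows with its edge; for cycles when
  -- `m′ < m`, since `Above` shrinks.
  Dominated : E → Sign → E → Set
  Dominated m ε m′ = _⊆_ {M} (R m) (R m′) × R m′ m ε

  module _ (comparable : ∀ {m ε m′ ε′} → T m ε → T m′ ε′ →
              (m ≡ m′ × ε ≡ ε′) ⊎ Dominated m ε m′ ⊎ Dominated m′ ε′ m) where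

    -- For one and the same arc, `both-signs-needless` applies. Otherwise the dominated arc leads
    -- from the end of its own return route back to the start and is available to the other one,
    -- which is the link that `uncross` asks for.
    opposite-returns : ∀ {m ε m′ ε′} → T m ε → T m′ ε′ →
                       Returns (_≡ Sign.+) m ε → Returns (_≡ Sign.-) m′ ε′ →
                       Route M (R m) (head m ε) (tail m ε) ⊎ Route M (R m′) (head m′ ε′) (tail m′ ε′)
    opposite-returns {m} {ε} {m′} {ε′} t t′ r r′ with comparable t t′
    ... | inj₁ (refl , refl)     = inj₁ (both-signs-needless r r′)
    ... | inj₂ (inj₁ (sub , a))  = uncross Sign.+ sub (arc m ε a) r r′
    ... | inj₂ (inj₂ (sub , a))  = [ inj₂ , inj₁ ]′ (uncross Sign.- sub (arc m′ ε′ a) r′ r)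

    private
      ∅ full : Sign → Set
      ∅ _ = ⊥
      full _ = ⊤

    -- If neither sign leaves a block, an arc blocked without `e` returns through `e^+` and through
    -- `e^-`, hence without `e`. If `m^ε` stays blocked under `+` and `m′^ε′` under `-`, each
    -- returns through the other sign, and uncrossing gives one of them a return without `e`.
    blocked-exactly-one : ¬ ¬ Blocked ∅ → ¬ Blocked full →
                          Dec (¬ Blocked (_≡ Sign.+)) → Dec (¬ Blocked (_≡ Sign.-)) →
                          ExactlyOne (¬ Blocked (_≡ Sign.+)) (¬ Blocked (_≡ Sign.-))
    blocked-exactly-one blocked∅ ¬blocked± dec₊ dec₋ = exactly-one dec₊ dec₋
      (λ (¬blocked₊ , ¬blocked₋) → blocked∅ λ (m , ε , t , ¬r) →
        ¬blocked₊ (m , ε , t , λ r₊ → ¬blocked₋ (m , ε , t , λ r₋ →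
          ¬r (mono inj₁ ([ id , id ]′ (opposite-returns t t r₊ r₋))))))
      (λ (blocked₊ , blocked₋) →
        blocked₊ λ (m , ε , t , ¬r₊) → blocked₋ λ (m′ , ε′ , t′ , ¬r′₋) →
        ¬blocked± (m , ε , t , λ r → [ ¬r₊ , (λ r₋ →
          ¬blocked± (m′ , ε′ , t′ , λ r′ → [ (λ r′₊ →
            [ ¬r′₋ ∘ mono inj₁ , ¬r₊ ∘ mono inj₁ ]′ (opposite-returns t′ t r′₊ r₋))
          , ¬r′₋ ]′ (one-sign-suffices r′))) ]′ (one-sign-suffices r)))

    -- A return route that may use both signs can do with one, so some sign links. If both do,
    -- `opposite-returns` yields a link without `e`.
    linked-exactly-one : ¬ ¬ Linked full → ¬ Linked ∅ →
                         Dec (¬ Linked (_≡ Sign.+)) → Dec (¬ Linked (_≡ Sign.-)) →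
                         ExactlyOne (¬ Linked (_≡ Sign.+)) (¬ Linked (_≡ Sign.-))
    linked-exactly-one linked± ¬linked∅ dec₊ dec₋ = exactly-one dec₊ dec₋
      (λ (¬linked₊ , ¬linked₋) → linked± λ (m , ε , t , r) →
        [ (λ r₊ → ¬linked₊ (m , ε , t , r₊)) , (λ r₋ → ¬linked₋ (m , ε , t , r₋)) ]′
          (one-sign-suffices r))
      (λ (linked₊ , linked₋) →
        linked₊ λ (m , ε , t , r₊) → linked₋ λ (m′ , ε′ , t′ , r′₋) →
        [ (λ r → ¬linked∅ (m , ε , t , mono inj₁ r)) , (λ r′ → ¬linked∅ (m′ , ε′ , t′ , mono inj₁ r′)) ]′
          (opposite-returns t t′ r₊ r′₋))

-- Adding orientations of an edge, and extension from a minor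

module _ (G : OOGraph) where
  open OOGraph G

  -- States that `O′` is `O` together with all `e^φ` for `φ` in `S`, so that the four fourientations
  -- of T2 can be treated at once.
  Adds : 𝔽 G → E → (Sign → Set) → 𝔽 G → Set
  Adds O e S O′ = ∀ f φ → O′ f φ ≡ true ⇔ (O f φ ≡ true ⊎ (f ≡ e × S φ))

  adds-elsewhere : ∀ {O e S O′} → Adds O e S O′ → ∀ {m} → m ≢ e → O m ≗ O′ m
  adds-elsewhere adds m≢e φ = Bool.⇔→≡ (mk⇔ (from ∘ inj₁) ([ id , (λ (m≡e , _) → ⊥-elim (m≢e m≡e)) ]′ ∘ to))
    where open Equivalence (adds _ φ)

  adds-none : ∀ {O e} → Adds O e (λ _ → ⊥) O
  adds-none f φ = mk⇔ inj₁ [ id , (λ ()) ∘ proj₂ ]′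

  only-true : ∀ {e f} → only G e f ≡ true → f ≡ e
  only-true {e} {f} p with f ≟ e
  ... | yes q = q

  only-self : ∀ e → only G e e ≡ true
  only-self e = dec-true (e ≟ e) refl

  only-false : ∀ {e f} → f ≢ e → only G e f ≡ false
  only-false {e} {f} = dec-false (f ≟ e)

  only-false⁻ : ∀ {e f} → only G e f ≡ false → f ≢ e
  only-false⁻ {e} p refl with () ← trans (sym p) (only-self e)

  adds-one : ∀ {O e} ε → Adds O e (_≡ ε) (add G O e ε)
  adds-one {O} {e} ε f φ with O f φ
  ... | true  = mk⇔ (λ _ → inj₁ refl) (λ _ → refl)
  ... | false with f ≟ e | φ Sign.≟ ε
  ...   | yes p | yes q = mk⇔ (λ _ → inj₂ (p , q)) (λ _ → refl)
  ...   | yes p | no ¬q = mk⇔ (λ ()) λ { (inj₁ ()) ; (inj₂ (_ , q)) → ⊥-elim (¬q q) }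
  ...   | no ¬p | _     = mk⇔ (λ ()) λ { (inj₁ ()) ; (inj₂ (p , _)) → ⊥-elim (¬p p) }

  adds-both : ∀ {O e} → Adds O e (λ _ → ⊤) (add G (add G O e Sign.+) e Sign.-)
  adds-both {O} {e} f φ = mk⇔
    (λ o → [ [ inj₁ , e-added ]′ ∘ to one₊ , e-added ]′ (to one₋ o))
    [ (λ o → from one₋ (inj₁ (from one₊ (inj₁ o)))) , (λ (p , _) → added p φ) ]′
    where
    open Equivalence using (to; from)
    one₊ = adds-one {O} {e} Sign.+ f φ
    one₋ = adds-one {add G O e Sign.+} {e} Sign.- f φ

    e-added : ∀ {ψ} → f ≡ e × φ ≡ ψ → O f φ ≡ true ⊎ (f ≡ e × ⊤)
    e-added (p , _) = inj₂ (p , tt)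

    added : f ≡ e → ∀ ψ → add G (add G O e Sign.+) e Sign.- f ψ ≡ true
    added p Sign.+ = from (adds-one {add G O e Sign.+} Sign.- f Sign.+)
                          (inj₁ (from (adds-one {O} Sign.+ f Sign.+) (inj₂ (p , refl))))
    added p Sign.- = from (adds-one {add G O e Sign.+} Sign.- f Sign.-) (inj₂ (p , refl))

  extend-outside : ∀ {D} (O : Outside graph D → Sign → Bool) {f} (p : D f ≡ false) φ →
                   extend G O f φ ≡ O (f ⊣ [ p ]) φ
  extend-outside {D} O {f} p φ with D f Bool.≟ false
  ... | yes _ = refl
  ... | no ¬p = ⊥-elim (¬p p)

  extend-inside : ∀ {D} (O : Outside graph D → Sign → Bool) {f} → D f ≡ true → ∀ φ →
                  extend G O f φ ≡ false
  extend-inside {D} O {f} p φ with D f Bool.≟ false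
  ... | yes q with () ← trans (sym p) q
  ... | no _  = refl

  value-outside : ∀ {D} (f : Outside graph D) → D (value f) ≡ false
  value-outside {D} (f ⊣ [ p ]) = recompute (D f Bool.≟ false) p

  extend-value : ∀ {D} (O : Outside graph D → Sign → Bool) f → extend G O (value f) ≗ O f
  extend-value O f = extend-outside O (value-outside f)

  extend-oriented : ∀ {e} (O : Outside graph (only G e) → Sign → Bool) {f φ} →
                    extend G O f φ ≡ true → f ≢ e
  extend-oriented {e} O {φ = φ} o refl with () ← trans (sym o) (extend-inside O (only-self e) φ)

-- Simple cuts from unreachability

does-true : ∀ {A : Set} (a? : Dec A) → does a? ≡ true → A
does-true (yes a) _ = a

does-false : ∀ {A : Set} (a? : Dec A) → does a? ≡ false → ¬ A
does-false (no ¬a) _ = ¬a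

module _ (M : Multigraph) where
  open Multigraph M

  ends⇒src,tgt : ∀ (Q : Pred V 0ℓ) e ε → Q (tail e ε) → Q (head e ε) → Q (src e) × Q (tgt e)
  ends⇒src,tgt Q e Sign.+ p q = p , q
  ends⇒src,tgt Q e Sign.- p q = q , p

  src,tgt⇒ends : ∀ (Q : Pred V 0ℓ) e → Q (src e) × Q (tgt e) → ∀ ε → Q (tail e ε)
  src,tgt⇒ends Q e (p , q) Sign.+ = p
  src,tgt⇒ends Q e (p , q) Sign.- = q

-- The vertices reached from h span a connected subgraph, as does the component
-- of t among the others; every other vertex is joined to h off that component.
module _ (G : OOGraph) {A : Arcs (OOGraph.graph G)}
         (A? : (e : OOGraph.E G) (ε : Sign) → Dec (A e ε))
         {h t : OOGraph.V G} (¬r : ¬ Route (OOGraph.graph G) A h t) where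
  open OOGraph G

  private
    Reached : Pred V 0ℓ
    Reached = Route graph A h

    Beyond : Pred E 0ℓ
    Beyond e = ¬ Reached (src e) × ¬ Reached (tgt e)

    beyond? : Decidable Beyond
    beyond? e = ¬? (route? A? h (src e)) ×-dec ¬? (route? A? h (tgt e))

    component? : ∀ v → Dec (Walk graph Beyond t v)
    component? = walk? beyond? t

    component-unreached : ∀ {v} → Walk graph Beyond t v → ¬ Reached v
    component-unreached w = go w ¬r
      where
      go : ∀ {u v} → Walk graph Beyond u v → ¬ Reached u → ¬ Reached v
      go (stay p)         ¬u r = ¬u (r ▷ stay (≈-sym p))
      go (step e ε b p w) ¬u   = go w (src,tgt⇒ends graph (¬_ ∘ Reached) e b (opposite ε))

  separation : Cut G
  separation = record
    { side      = λ v → does (component? v)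
    ; side-resp = λ p → does-⇔ (mk⇔ (_◅◅ stay p) (_◅◅ stay (≈-sym p))) (component? _) (component? _)
    ; nonempty  = λ { true  → t , dec-true (component? t) (stay ≈-refl)
                    ; false → h , dec-false (component? h) (λ w → component-unreached w (stay ≈-refl)) }
    }

  private
    open module Sep = Cut separation using (side)

    inside : ∀ {v} → Walk graph Beyond t v → side v ≡ true
    inside = dec-true (component? _)

    outside : ∀ {v} → ¬ Walk graph Beyond t v → side v ≡ false
    outside = dec-false (component? _)

    reached-outside : ∀ {v} → Reached v → side v ≡ false
    reached-outside r = outside λ w → component-unreached w r

    Within : Bool → Pred E 0ℓ
    Within b e = side (src e) ≡ b × side (tgt e) ≡ b

    extend-walk : ∀ {S : Pred E 0ℓ} {u} e ε → S e →
                  Walk graph S u (tail e ε) → Walk graph S u (head e ε)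
    extend-walk e ε s w = w ◅◅ along e ε s

    -- Were the head unreached too, the edge would lie in `Beyond` and the head in the component of
    -- `t`.
    neighbour-reached : ∀ e ε → side (tail e ε) ≡ true → side (head e ε) ≡ false → Reached (head e ε)
    neighbour-reached e ε p q = decidable-stable (route? A? h (head e ε)) λ ¬r′ →
      let w = does-true (component? (tail e ε)) p in
      does-false (component? (head e ε)) q
        (extend-walk e ε (ends⇒src,tgt graph (¬_ ∘ Reached) e ε (component-unreached w) ¬r′) w)

    within-component : ∀ {v} → Walk graph Beyond t v → Walk graph (Within true) t v
    within-component = go (stay ≈-refl)
      where
      go : ∀ {u v} → Walk graph Beyond t u → Walk graph Beyond u v → Walk graph (Within true) u v
      go w (stay p)          = stay p
      go w (step e ε b p w′) = step e ε within p (go v w′)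
        where
        u = w ◅◅ stay p
        v = extend-walk e ε b u
        within = ends⇒src,tgt graph (λ v → side v ≡ true) e ε (inside u) (inside v)

    within-reached : ∀ {v} → Reached v → Walk graph (Within false) h v
    within-reached = go (stay ≈-refl)
      where
      go : ∀ {u v} → Reached u → Route graph A u v → Walk graph (Within false) u v
      go r (stay p)          = stay p
      go r (step e ε a p r′) = step e ε within p (go v r′)
        where
        u = r ▷ stay p
        v = u ▷ arc e ε a
        within = ends⇒src,tgt graph (λ v → side v ≡ false) e ε
                   (reached-outside u) (reached-outside v)

    -- Follow any walk to `h` until it is about to enter the component of `t`. The vertex before
    -- that step is a neighbour of the component, hence reached, and a route from `h` to it can be
    -- walked backwards.
    to-h : ∀ {v} → side v ≡ false → Walk graph (Within false) v h
    to-h {v} = go (walk v h)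
      where
      go : ∀ {v} → Walk graph (AnyEdge graph) v h → side v ≡ false → Walk graph (Within false) v h
      go (stay p) _ = stay p
      go (step e ε _ p w) v∉ with side (head e ε) in eq
      ... | false = step e ε (ends⇒src,tgt graph (λ v → side v ≡ false) e ε u∉ eq) p (go w eq)
        where u∉ = trans (sym (Sep.side-resp p)) v∉
      ... | true  = respˡ p (reverse (within-reached
        (subst Reached (head-opposite e ε) (neighbour-reached e (opposite ε) eq
          (trans (cong side (head-opposite e ε)) (trans (sym (Sep.side-resp p)) v∉))))))

  separation-simple : Cut.Simple separation
  separation-simple true u v p q =
    reverse (within-component (does-true (component? u) p))
      ◅◅ within-component (does-true (component? v) q)
  separation-simple false u v p q = to-h p ◅◅ reverse (to-h q)

  separation-start : side h ≡ false
  separation-start = reached-outside (stay ≈-refl)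

  separation-end : side t ≡ true
  separation-end = inside (stay ≈-refl)

  -- The head of a crossing edge is reached, so an arc from it into the component would make a
  -- vertex of the component reached.
  separation-closed : ∀ e ε → Cut.Directed separation e ε → ¬ A e (opposite ε)
  separation-closed e ε (p , q) a = component-unreached (does-true (component? (tail e ε)) p)
    (subst Reached (head-opposite e ε) (neighbour-reached e ε p q ▷ arc e (opposite ε) a))

-- Directions across a cut, and arcs of minors

module _ {G : OOGraph} (Cu : Cut G) where
  open OOGraph G
  open Cut Cu

  crosses⇒directed : ∀ {e} → Edges e → ∃[ ε ] Directed e ε
  crosses⇒directed {e} c with side (src e) in p | side (tgt e) in q
  ... | true  | false = Sign.+ , p , q
  ... | false | true  = Sign.- , q , p

  directed⇒crosses : ∀ {e} ε → Directed e ε → Edges e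
  directed⇒crosses Sign.+ (p , q) = cong₂ _xor_ p q
  directed⇒crosses Sign.- (p , q) = cong₂ _xor_ q p

  directed-unique : ∀ {e ε φ} → Directed e ε → Directed e φ → ε ≡ φ
  directed-unique {ε = Sign.+} {Sign.+} _ _ = refl
  directed-unique {ε = Sign.-} {Sign.-} _ _ = refl
  directed-unique {ε = Sign.+} {Sign.-} (p , _) (_ , q) with () ← trans (sym p) q
  directed-unique {ε = Sign.-} {Sign.+} (p , _) (_ , q) with () ← trans (sym p) q

  off-cut⇒same-side : ∀ {e} → offCut G Cu e ≡ true → ∀ ε → side (tail e ε) ≡ side (head e ε)
  off-cut⇒same-side {e} c ε with side (src e) in p | side (tgt e) in q
  off-cut⇒same-side c Sign.+ | true  | true  = trans p (sym q)
  off-cut⇒same-side c Sign.- | true  | true  = trans q (sym p)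
  off-cut⇒same-side c Sign.+ | false | false = trans p (sym q)
  off-cut⇒same-side c Sign.- | false | false = trans q (sym p)

  -- Makes the cut survive as a cut of the contraction `cutMinor G Cu`.
  side-contracted : ∀ {u v} → Walk graph (λ e → offCut G Cu e ≡ true) u v → side u ≡ side v
  side-contracted (stay p)         = side-resp p
  side-contracted (step e ε c p w) = trans (side-resp p) (trans (off-cut⇒same-side c ε) (side-contracted w))

module _ {M : Multigraph} {C : Multigraph.E M → Bool} where
  private
    module M = Multigraph M
    module D = Multigraph (deleteEdges M C)
    module K = Multigraph (contractEdges M C)

  tail-deleted : ∀ f ε → D.tail f ε ≡ M.tail (value f) ε
  tail-deleted f Sign.+ = refl
  tail-deleted f Sign.- = refl

  tail-contracted : ∀ f ε → K.tail f ε ≡ M.tail (value f) ε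
  tail-contracted f Sign.+ = refl
  tail-contracted f Sign.- = refl

-- Min-edge cut properties

module CutProperty (datum : MinEdgeCutDatum) where
  open MinEdgeCutDatum datum

  -- m^ε is the direction that a bad potential cut with minimum edge m takes.
  Active : (Sign → Bool) → Sign → Set
  Active o ε = X (o Sign.+ , o Sign.-) ≡ true × o (opposite ε) ≡ false ×
               ((∀ φ → o φ ≡ false) → ε ≡ δ)

  active? : ∀ o ε → Dec (Active o ε)
  active? o ε = (X _ Bool.≟ true) ×-dec (o (opposite ε) Bool.≟ false) ×-dec
                (∀-sign? (λ φ → o φ Bool.≟ false) →-dec (ε Sign.≟ δ))

  active-resp : ∀ {o o′ ε} → o ≗ o′ → Active o ε → Active o′ ε
  active-resp eq (x , out , un) =
    trans (sym (cong X (cong₂ _,_ (eq Sign.+) (eq Sign.-)))) x ,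
    trans (sym (eq _)) out ,
    λ none → un λ φ → trans (eq φ) (none φ)

  -- Were both signs active, the edge would be unoriented, and then each of them is `δ`.
  active-unique : ∀ {o ε φ} → Active o ε → Active o φ → ε ≡ φ
  active-unique {ε = Sign.+} {Sign.+} _ _ = refl
  active-unique {ε = Sign.-} {Sign.-} _ _ = refl
  active-unique {ε = Sign.+} {Sign.-} (_ , p , un) (_ , q , un′) =
    trans (un none) (sym (un′ none))
    where none = λ { Sign.+ → q ; Sign.- → p }
  active-unique {ε = Sign.-} {Sign.+} (_ , p , un) (_ , q , un′) =
    trans (un none) (sym (un′ none))
    where none = λ { Sign.+ → p ; Sign.- → q }

  module _ (G : OOGraph) (O : 𝔽 G) where
    open OOGraph G
    open IsStrictTotalOrder isStrictTotalOrder using (_<?_)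

    Below : E → Arcs graph
    Below m f φ = O f φ ≡ true ⊎ f < m

    below? : ∀ m f φ → Dec (Below m f φ)
    below? m f φ = (O f φ Bool.≟ true) ⊎-dec (f <? m)

    Obstruction : Arcs graph
    Obstruction m ε = Active (O m) ε × ¬ Route graph (Below m) (head m ε) (tail m ε)

    Obstructed : Set
    Obstructed = ∃[ m ] ∃[ ε ] Obstruction m ε

    obstructed? : Dec Obstructed
    obstructed? = ∃-arc? {M = graph} λ m ε →
      active? (O m) ε ×-dec ¬? (route? (below? m) (head m ε) (tail m ε))

    MinimumCut : E → Sign → Cut G → Set
    MinimumCut m ε Cu = PotentialCut G O Cu × IsMinimumOf graph (Cut.Edges Cu) m × Cut.Directed Cu m ε

  module _ {G : OOGraph} {O : 𝔽 G} where
    open OOGraph G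

    -- No arc of `O` enters `U`, as the cut is potential, and no edge below its minimum crosses it
    -- at all.
    minimum-cut-closed : ∀ {m ε Cu} → MinimumCut G O m ε Cu → let open Cut Cu in
                         ∀ f φ → Below G O m f φ → side (tail f φ) ≡ false → side (head f φ) ≡ false
    minimum-cut-closed {m} {ε} {Cu} (pot , (_ , min) , _) f φ b p with Cut.side Cu (head f φ) in q
    ... | false = refl
    ... | true  = ⊥-elim (impossible b)
      where
      directed : Cut.Directed Cu f (opposite φ)
      directed = q , trans (cong (Cut.side Cu) (head-opposite f φ)) p

      impossible : ¬ Below G O m f φ
      impossible (inj₁ o) with () ←
        trans (sym o) (trans (cong (O f) (sym (Sign.opposite-involutive φ)))
                             (pot f (opposite φ) directed))
      impossible (inj₂ f<m) with min f (directed⇒crosses Cu (opposite φ) directed)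
      ... | inj₁ refl = <-irrefl refl f<m
      ... | inj₂ m<f  = <-irrefl refl (<-trans f<m m<f)

    -- Take the separation of the head of `m^ε` from its tail. No arc of `O` enters the side of the
    -- tail, so the cut is potential; edges below `m` are available in both directions, so none of
    -- them crosses.
    obstruction⇒cut : ∀ {m ε} → Obstruction G O m ε → ∃[ Cu ] (Cut.Simple Cu × MinimumCut G O m ε Cu)
    obstruction⇒cut {m} {ε} (_ , ¬r) =
      Cu , separation-simple G (below? G O m) ¬r , potential , minimum , directed
      where
      Cu = separation G (below? G O m) ¬r
      open Cut Cu

      closed = separation-closed G (below? G O m) ¬r

      directed : Directed m ε
      directed = separation-end G (below? G O m) ¬r , separation-start G (below? G O m) ¬r

      potential : PotentialCut G O Cu
      potential e φ d with O e (opposite φ) in eq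
      ... | false = refl
      ... | true  = ⊥-elim (closed e φ d (inj₁ eq))

      minimum : IsMinimumOf graph Edges m
      minimum = directed⇒crosses Cu ε directed , min
        where
        min : ∀ f → Edges f → f ≡ m ⊎ m < f
        min f c with compare f m
        ... | tri≈ _ f≡m _ = inj₁ f≡m
        ... | tri> _ _ m<f = inj₂ m<f
        ... | tri< f<m _ _ =
          let φ , d = crosses⇒directed Cu c in ⊥-elim (closed f φ d (inj₂ f<m))

    minimum-cut-bad : ∀ {m ε Cu} → Active (O m) ε → MinimumCut G O m ε Cu → BadCut datum G O Cu
    minimum-cut-bad {m} {Cu = Cu} (x , _ , un) (_ , min , d) =
      m , min , x , λ none → subst (Cut.Directed Cu m) (un none) d

    bad-cut⇒obstructed : ∀ {Cu} → PotentialCut G O Cu → BadCut datum G O Cu → Obstructed G O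
    bad-cut⇒obstructed {Cu} pot (m , min , x , un) =
      m , ε , (x , pot m ε d , λ none → directed-unique Cu {ε = ε} d (un none)) , ¬r
      where
      open Cut Cu
      ε = proj₁ (crosses⇒directed Cu (proj₁ min))
      d = proj₂ (crosses⇒directed Cu (proj₁ min))

      ¬r : ¬ Route graph (Below G O m) (head m ε) (tail m ε)
      -- A route from the head of `m^ε` starts outside `U` and cannot enter it, but the tail lies in
      -- `U`.
      ¬r r with () ← trans (sym (proj₁ d)) (fold (λ u v → side u ≡ false → side v ≡ false)
        (λ p → trans (sym (side-resp p))) (λ f g → g ∘ f)
        (minimum-cut-closed {ε = ε} {Cu} (pot , min , d)) r (proj₂ d))

  -- Turns a statement about all cuts into finitely many reachability questions. Decidability and
  -- the other axioms are then proved for these.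
  good⇔ : ∀ G O → minEdgeCut datum G O ⇔ (¬ Obstructed G O)
  good⇔ G O = mk⇔
    (λ good (m , ε , obs) → let Cu , _ , min = obstruction⇒cut obs in
      good Cu (proj₁ min) (minimum-cut-bad {Cu = Cu} (proj₁ obs) min))
    (λ ¬obs Cu pot bad → ¬obs (bad-cut⇒obstructed {Cu = Cu} pot bad))

  good? : ∀ G O → Dec (minEdgeCut datum G O)
  good? G O = map′ (Equivalence.from (good⇔ G O)) (Equivalence.to (good⇔ G O)) (¬? (obstructed? G O))

  T1 : ∀ G O → ¬ minEdgeCut datum G O → ∃[ Cu ] PotentialCut G O Cu
  T1 G O bad with obstructed? G O
  ... | yes (m , ε , obs) = let Cu , _ , pot , _ = obstruction⇒cut obs in Cu , pot
  ... | no ¬obs           = ⊥-elim (bad (Equivalence.from (good⇔ G O) ¬obs))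

  module _ {G : OOGraph} {O : 𝔽 G} {H : OOGraph} {O′ : 𝔽 H} (iso : Isomorphism G O H O′) where
    private
      module G = OOGraph G
      module H = OOGraph H
    open Isomorphism iso
    open IsomorphismProperties iso

    -- Routes are carried forward by the isomorphism, so their absence is carried backward.
    obstruction-pull : ∀ m ε → Obstruction H O′ (emap m) ε → Obstruction G O m ε
    obstruction-pull m ε (active , ¬r) = active-resp (sym ∘ O-compat m) active , λ r → ¬r
      (prepend (H.≈-sym (tail-compat m (opposite ε))) (route-map below r) ▷ stay (tail-compat m ε))
      where
      below : ∀ {f φ} → Below G O m f φ → Below H O′ (emap m) (emap f) φ
      below (inj₁ o)   = inj₁ (trans (sym (O-compat _ _)) o)
      below (inj₂ f<m) = inj₂ (Equivalence.to (order-compat _ _) f<m)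

    good-transfer : minEdgeCut datum G O → minEdgeCut datum H O′
    good-transfer good = Equivalence.from (good⇔ H O′) λ (m , ε , obs) → Equivalence.to (good⇔ G O) good
      (from m , ε , obstruction-pull (from m) ε
        (subst (λ m → Obstruction H O′ m ε) (sym (strictlyInverseˡ m)) obs))
      where open Inverse onE using (from; strictlyInverseˡ)

  isFourientationProperty : IsFourientationProperty (minEdgeCut datum)
  isFourientationProperty = record
    { good?     = good?
    ; invariant = λ iso → mk⇔ (good-transfer iso) (good-transfer (IsomorphismProperties.inverse-iso iso))
    }

  private P = minEdgeCut datum

  -- Contraction to a cut

  module _ {G : OOGraph} {O : 𝔽 G} (Cu : Cut G) where
    open OOGraph G
    private
      K = cutMinor G Cu
      module K = OOGraph K

    -- An arc off the cut becomes an equality of vertices, and an arc of the cut stays an arc.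
    route-contracted : ∀ {m u v} → Route graph (Below G O (value m)) u v →
                       Route K.graph (Below K (restrict G O) m) u v
    route-contracted {m} = fold {M = graph} (Route K.graph _) (λ p → stay (stay p)) _▷_ contracted
      where
      contracted : ∀ f φ → Below G O (value m) f φ →
                   Route K.graph (Below K (restrict G O) m) (tail f φ) (head f φ)
      contracted f φ b with offCut G Cu f in eq
      ... | true  = stay (along f φ eq)
      ... | false = subst₂ (Route K.graph _)
        (tail-contracted f′ φ) (tail-contracted f′ (opposite φ)) (arc f′ φ b)
        where
        f′ : K.E
        f′ = f ⊣ [ eq ]

    minor-obstructed⇒obstructed : Obstructed K (restrict G O) → Obstructed G O
    minor-obstructed⇒obstructed (m , ε , active , ¬r) = value m , ε , active , λ r → ¬r
      (subst₂ (Route K.graph _) (sym (tail-contracted m (opposite ε))) (sym (tail-contracted m ε))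
        (route-contracted {m} r))

    -- The edge `m` crosses `Cu` and so is not contracted, and `side` remains well defined. Closure
    -- of `Uᶜ` then forbids a return route in the minor just as in `G`.
    minimum-cut⇒minor-obstructed : ∀ {m ε} → Active (O m) ε → MinimumCut G O m ε Cu →
                                   Obstructed K (restrict G O)
    minimum-cut⇒minor-obstructed {m} {ε} active min@(pot , (c , _) , d) =
      m′ , ε , active , ¬r
      where
      open Cut Cu

      m′ : K.E
      m′ = m ⊣ [ cong not c ]

      closed : ∀ f φ → Below K (restrict G O) m′ f φ →
               side (K.tail f φ) ≡ false → side (K.head f φ) ≡ false
      closed f φ b p = trans (cong side (tail-contracted f (opposite φ)))
        (minimum-cut-closed {ε = ε} {Cu} min (value f) φ b
          (trans (cong side (sym (tail-contracted f φ))) p))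

      ¬r : ¬ Route K.graph (Below K (restrict G O) m′) (K.head m′ ε) (K.tail m′ ε)
      ¬r r with () ← trans (sym (trans (cong side (tail-contracted m′ ε)) (proj₁ d)))
        (fold (λ u v → side u ≡ false → side v ≡ false)
              (λ w → trans (sym (side-contracted Cu w))) (λ f g → g ∘ f) closed r
              (trans (cong side (tail-contracted m′ (opposite ε))) (proj₂ d)))

  isCutProperty : IsCutProperty P
  isCutProperty G O = mk⇔
    (λ good Cu _ → from (good⇔ _ _) (to (good⇔ G O) good ∘ minor-obstructed⇒obstructed Cu))
    (λ minors-good → from (good⇔ G O) λ (m , ε , obs) →
      let Cu , simple , min = obstruction⇒cut obs in
      to (good⇔ _ _) (minors-good Cu simple) (minimum-cut⇒minor-obstructed Cu (proj₁ obs) min))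
    where open Equivalence using (to; from)

  -- T2 for cuts: the maximum edge is deleted

  module _ (G : OOGraph) {e : OOGraph.E G} (e-max : IsMaximum (OOGraph.graph G) e)
           (¬isthmus : ¬ IsIsthmus G e) (O : 𝔽 (delete G e ¬isthmus)) where
    open OOGraph G
    private
      D = delete G e ¬isthmus
      module D = OOGraph D

    O₀ : 𝔽 G
    O₀ = extend G O

    Target : Arcs graph
    Target m ε = m ≢ e × Active (O₀ m) ε

    below-max : ∀ {m} → m ≢ e → m < e
    below-max {m} m≢e = [ (λ m≡e → ⊥-elim (m≢e m≡e)) , id ]′ (e-max m)

    -- The graph without `e` is connected. As all other edges lie below `e`, such a route excludes
    -- an obstruction at `e`.
    bypass : ∀ u v → Route graph (λ f _ → f ≢ e) u v
    bypass u v = fold {M = D.graph} (Route graph _) stay _▷_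
      (λ f φ _ → subst₂ (Route graph _) (sym (tail-deleted f φ)) (sym (tail-deleted f (opposite φ)))
        (arc (value f) φ (only-false⁻ G (value-outside G f))))
      (along-edges {A = λ _ _ → ⊤} (λ _ _ → tt) (D.walk u v))

    obstructed⇔blocked : ∀ {S O′} → Adds G O₀ e S O′ →
                         Obstructed G O′ ⇔ Blocked graph e Target (Below G O₀) S
    obstructed⇔blocked {S} {O′} adds = mk⇔
      (λ (m , ε , active , ¬r) →
        let m≢e = λ { refl → ¬r (mono (inj₂ ∘ below-max) (bypass _ _)) } in
        m , ε , (m≢e , active-resp (sym ∘ adds-elsewhere G adds m≢e) active) , ¬r ∘ mono to′)
      (λ (m , ε , (m≢e , active) , ¬r) →
        m , ε , active-resp (adds-elsewhere G adds m≢e) active , ¬r ∘ mono from′)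
      where
      open Equivalence using (to; from)

      to′ : ∀ {m f φ} → (Below G O₀ m f φ ⊎ (f ≡ e × S φ)) → Below G O′ m f φ
      to′ (inj₁ (inj₁ o))   = inj₁ (from (adds _ _) (inj₁ o))
      to′ (inj₁ (inj₂ f<m)) = inj₂ f<m
      to′ (inj₂ s)          = inj₁ (from (adds _ _) (inj₂ s))

      from′ : ∀ {m f φ} → Below G O′ m f φ → Below G O₀ m f φ ⊎ (f ≡ e × S φ)
      from′ (inj₂ f<m) = inj₁ (inj₂ f<m)
      from′ (inj₁ o)   = [ inj₁ ∘ inj₁ , inj₂ ]′ (to (adds _ _) o)

    -- In `O₀` the edge `e` is unoriented, and being the maximum it is below no edge, so the routes
    -- in question never use it.
    delete-obstructed⇔blocked : Obstructed D O ⇔ Blocked graph e Target (Below G O₀) (λ _ → ⊥)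
    delete-obstructed⇔blocked = mk⇔
      (λ (m , ε , active , ¬r) →
        value m , ε ,
        (only-false⁻ G (value-outside G m) , active-resp (sym ∘ extend-value G O m) active) ,
        λ r → ¬r (subst₂ (Route D.graph _)
          (sym (tail-deleted m (opposite ε))) (sym (tail-deleted m ε)) (down {m} r)))
      (λ (m , ε , (m≢e , active) , ¬r) →
        let m′ = m ⊣ [ only-false G m≢e ] in
        m′ , ε , active-resp (extend-value G O m′) active ,
        λ r → ¬r (subst₂ (Route graph _)
          (tail-deleted m′ (opposite ε)) (tail-deleted m′ ε) (up {m′} r)))
      where
      not-max : ∀ {m f} → f < m → f ≢ e
      not-max {m} e<m refl with e-max m
      ... | inj₁ refl = <-irrefl refl e<m
      ... | inj₂ m<e  = <-irrefl refl (<-trans m<e e<m)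

      down : ∀ {m u v} → Route graph (λ f φ → Below G O₀ (value m) f φ ⊎ (f ≡ e × ⊥)) u v →
             Route D.graph (Below D O m) u v
      down {m} = fold {M = graph} (Route D.graph _) stay _▷_ λ where
          f φ (inj₁ (inj₁ o))   → kept f φ (extend-oriented G O o)
            (λ p → inj₁ (trans (sym (extend-outside G O p φ)) o))
          f φ (inj₁ (inj₂ f<m)) → kept f φ (not-max f<m) (λ _ → inj₂ f<m)
        where
        kept : ∀ f φ → f ≢ e → ((p : only G e f ≡ false) → Below D O m (f ⊣ [ p ]) φ) →
               Route D.graph (Below D O m) (tail f φ) (head f φ)
        kept f φ f≢e b = subst₂ (Route D.graph _) (tail-deleted f′ φ) (tail-deleted f′ (opposite φ))
                           (arc f′ φ (b (only-false G f≢e)))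
          where
          f′ : D.E
          f′ = f ⊣ [ only-false G f≢e ]

      up : ∀ {m u v} → Route D.graph (Below D O m) u v →
           Route graph (λ f φ → Below G O₀ (value m) f φ ⊎ (f ≡ e × ⊥)) u v
      up = fold {M = D.graph} (Route graph _) stay _▷_ λ f φ b →
        subst₂ (Route graph _) (sym (tail-deleted f φ)) (sym (tail-deleted f (opposite φ)))
          (arc (value f) φ (inj₁ ([ (λ o → inj₁ (trans (extend-value G O f φ) o)) , inj₂ ]′ b)))

    comparable : ∀ {m ε m′ ε′} → Target m ε → Target m′ ε′ →
                 (m ≡ m′ × ε ≡ ε′) ⊎ Dominated graph e Target (Below G O₀) m ε m′
                                   ⊎ Dominated graph e Target (Below G O₀) m′ ε′ m
    comparable {m} {_} {m′} (_ , active) (_ , active′) with compare m m′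
    ... | tri≈ _ refl _ = inj₁ (refl , active-unique active active′)
    ... | tri< m<m′ _ _ = inj₂ (inj₁ ([ inj₁ , (λ f<m → inj₂ (<-trans f<m m<m′)) ]′ , inj₂ m<m′))
    ... | tri> _ _ m′<m = inj₂ (inj₂ ([ inj₁ , (λ f<m′ → inj₂ (<-trans f<m′ m′<m)) ]′ , inj₂ m′<m))

    cutT2 : CutT2 P G e ¬isthmus O
    cutT2 = record
      -- More arcs give more return routes, hence fewer blocks.
      { a = λ good → let ok = to deleted good in
              from unblocked₊ (λ (m , ε , t , ¬r) → ok (m , ε , t , λ r → ¬r (mono weaken∅ r)))
            , from unblocked₋ (λ (m , ε , t , ¬r) → ok (m , ε , t , λ r → ¬r (mono weaken∅ r)))
      ; b = λ bad good →
          [ (λ (g , b) → inj₁ (from unblocked₊ g , b ∘ to unblocked₋))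
          , (λ (b , g) → inj₂ (b ∘ to unblocked₊ , from unblocked₋ g)) ]′
          (blocked-exactly-one graph e Target (Below G O₀) comparable
            (bad ∘ from deleted) (to (unblocked (adds-both G)) good)
            (map′ (to unblocked₊) (from unblocked₊) (good? G _))
            (map′ (to unblocked₋) (from unblocked₋) (good? G _)))
      ; c = mk⇔ (from (unblocked (adds-none G)) ∘ to deleted)
                (from deleted ∘ to (unblocked (adds-none G)))
      }
      where
      open Equivalence using (to; from)

      unblocked : ∀ {S O′} → Adds G O₀ e S O′ → P G O′ ⇔ (¬ Blocked graph e Target (Below G O₀) S)
      unblocked adds = mk⇔ (λ good → to (good⇔ _ _) good ∘ from (obstructed⇔blocked adds))
                           (λ ok → from (good⇔ _ _) (ok ∘ to (obstructed⇔blocked adds)))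

      unblocked₊ = unblocked (adds-one G Sign.+)
      unblocked₋ = unblocked (adds-one G Sign.-)

      deleted : P D O ⇔ (¬ Blocked graph e Target (Below G O₀) (λ _ → ⊥))
      deleted = mk⇔ (λ good → to (good⇔ _ _) good ∘ from delete-obstructed⇔blocked)
                    (λ ok → from (good⇔ _ _) (ok ∘ to delete-obstructed⇔blocked))

      weaken∅ : ∀ {A : Set} {B C : Set} → A ⊎ (B × ⊥) → A ⊎ (B × C)
      weaken∅ (inj₁ a) = inj₁ a

  isTutteCutProperty : IsTutteCutProperty P
  isTutteCutProperty = record
    { isFourientationProperty = isFourientationProperty
    ; isCutProperty           = isCutProperty
    ; T1                      = T1
    ; T2                      = λ G e e-max ¬isthmus _ O → cutT2 G e-max ¬isthmus O
    }

-- Loop erasure, and closing a simple route to a cycle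

module _ {M : Multigraph} where
  open Multigraph M

  tailₐ headₐ : E × Sign → V
  tailₐ = uncurry tail
  headₐ = uncurry head

  module _ {A : Arcs M} where

    Visits : ∀ {u v} → V → Route M A u v → Set
    Visits {v = v} x (stay _)         = x ≈ v
    Visits         x (step e ε _ _ r) = x ≈ tail e ε ⊎ Visits x r

    Simple : ∀ {u v} → Route M A u v → Set
    Simple (stay _)         = ⊤
    Simple (step e ε _ _ r) = ¬ Visits (tail e ε) r × Simple r

    visits? : ∀ {u v} x (r : Route M A u v) → Dec (Visits x r)
    visits? x (stay _)         = x ≈? _
    visits? x (step e ε _ _ r) = (x ≈? tail e ε) ⊎-dec visits? x r

    visits-resp : ∀ {u v x y} (r : Route M A u v) → x ≈ y → Visits y r → Visits x r
    visits-resp (stay _)         p q        = ≈-trans p q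
    visits-resp (step _ _ _ _ r) p (inj₁ q) = inj₁ (≈-trans p q)
    visits-resp (step _ _ _ _ r) p (inj₂ w) = inj₂ (visits-resp r p w)

    visits-start : ∀ {u v} (r : Route M A u v) → Visits u r
    visits-start (stay p)         = p
    visits-start (step _ _ _ p _) = inj₁ p

    visits-end : ∀ {u v} (r : Route M A u v) → Visits v r
    visits-end (stay _)         = ≈-refl
    visits-end (step _ _ _ _ r) = inj₂ (visits-end r)

    suffix : ∀ {u v x} (r : Route M A u v) → Simple r → Visits x r → Σ (Route M A x v) Simple
    suffix (stay _)         _          q        = stay q , tt
    suffix (step e ε a _ r) s          (inj₁ q) = step e ε a q r , s
    suffix (step _ _ _ _ r) (_ , s)    (inj₂ w) = suffix r s w

    -- Erase the loops of the rest first; if it still visits the starting vertex, only its part from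
    -- that visit on is kept.
    loop-erase : ∀ {u v} → Route M A u v → Σ (Route M A u v) Simple
    loop-erase (stay p) = stay p , tt
    loop-erase (step e ε a p r) with loop-erase r
    ... | r′ , s with visits? (tail e ε) r′
    ...   | yes w = suffix r′ s (visits-resp r′ p w)
    ...   | no ¬w = step e ε a p r′ , ¬w , s

    arcs : ∀ {u v} → Route M A u v → List (E × Sign)
    arcs (stay _)         = []
    arcs (step e ε _ _ r) = (e , ε) ∷ arcs r

    arcs-allowed : ∀ {u v} (r : Route M A u v) → All (uncurry A) (arcs r)
    arcs-allowed (stay _)         = []
    arcs-allowed (step _ _ a _ r) = a ∷ arcs-allowed r

    arcs-visited : ∀ {u v} (r : Route M A u v) →
                   All (λ a → Visits (tailₐ a) r × Visits (headₐ a) r) (arcs r)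
    arcs-visited (stay _)         = []
    arcs-visited (step _ _ _ _ r) =
      (inj₁ ≈-refl , inj₂ (visits-start r)) ∷ All.map (λ (p , q) → inj₂ p , inj₂ q) (arcs-visited r)

    tails-before-end : ∀ {u v} (r : Route M A u v) → Simple r → All (λ a → ¬ (tailₐ a ≈ v)) (arcs r)
    tails-before-end (stay _)         _        = []
    tails-before-end (step _ _ _ _ r) (¬w , s) =
      (λ p → ¬w (visits-resp r p (visits-end r))) ∷ tails-before-end r s

    chain-step : ∀ {v} e ε (r : Route M A (head e ε) v) i →
                 headₐ (lookup ((e , ε) ∷ arcs r) (inject₁ i)) ≈ tailₐ (lookup (arcs r) i)
    chain-step e ε (step f φ _ p r) zero    = p
    chain-step e ε (step f φ _ p r) (suc i) = chain-step f φ r i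

    chain-last : ∀ {v} e ε (r : Route M A (head e ε) v) →
                 headₐ (lookup ((e , ε) ∷ arcs r) (fromℕ (length (arcs r)))) ≈ v
    chain-last e ε (stay p)         = p
    chain-last e ε (step f φ _ _ r) = chain-last f φ r

    chain-closed : ∀ e ε (r : Route M A (head e ε) (tail e ε)) i → let as = (e , ε) ∷ arcs r in
                   headₐ (lookup as i) ≈ tailₐ (lookup as (next i))
    chain-closed e ε r i with view i
    ... | ‵fromℕ     = chain-last e ε r
    ... | ‵inject₁ j = chain-step e ε r j

  -- The two components give `Simple` and `edge-distinct` of the cycle built from the arcs.
  Apart : E × Sign → E × Sign → Set
  Apart a b = ¬ (tailₐ a ≈ tailₐ b) × proj₁ a ≢ proj₁ b

  apart-sym : ∀ a b → Apart a b → Apart b a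
  apart-sym _ _ (p , q) = p ∘ ≈-sym , q ∘ sym

  same-edge⇒tail-is-end : ∀ e ε φ → tail e ε ≈ tail e φ ⊎ tail e ε ≈ head e φ
  same-edge⇒tail-is-end e Sign.+ Sign.+ = inj₁ ≈-refl
  same-edge⇒tail-is-end e Sign.+ Sign.- = inj₂ ≈-refl
  same-edge⇒tail-is-end e Sign.- Sign.+ = inj₂ ≈-refl
  same-edge⇒tail-is-end e Sign.- Sign.- = inj₁ ≈-refl

  -- A later arc over the same edge would have the tail of the first arc as one of its ends, so the
  -- rest of the route would visit it again.
  arcs-apart : ∀ {A u v} (r : Route M A u v) → Simple r → AllPairs Apart (arcs r)
  arcs-apart (stay _)         _        = []
  arcs-apart (step e ε _ _ r) (¬w , s) = All.map (λ {b} → apart {b}) (arcs-visited r) ∷ arcs-apart r s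
    where
    apart : ∀ {b} → Visits (tailₐ b) r × Visits (headₐ b) r → Apart (e , ε) b
    apart {f , φ} (p , q) = (λ t → ¬w (visits-resp r t p)) , λ { refl →
      ¬w ([ (λ t → visits-resp r t p) , (λ t → visits-resp r t q) ]′ (same-edge⇒tail-is-end e ε φ)) }

  apart-lookup : ∀ {as} → AllPairs Apart as → ∀ i j → i ≢ j → Apart (lookup as i) (lookup as j)
  apart-lookup (_ ∷ _)   zero    zero    i≢j = ⊥-elim (i≢j refl)
  apart-lookup (ps ∷ _)  zero    (suc j) _   = All.lookup ps (∈-lookup j)
  apart-lookup {a ∷ as} (ps ∷ _) (suc i) zero _ =
    apart-sym a (lookup as i) (All.lookup ps (∈-lookup i))
  apart-lookup (_ ∷ pss) (suc i) (suc j) i≢j = apart-lookup pss i j (i≢j ∘ cong suc)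

-- Induction around the cycle from an arbitrary start: up from `i` to the last index, over to
-- `zero`, and up again to `j`.
next-closed : ∀ {k} (Q : Fin (suc k) → Set) → (∀ i → Q i → Q (next i)) → ∀ {i} → Q i → ∀ j → Q j
next-closed {k} Q closed {i} q = <-weakInduction Q q₀ λ i → subst Q (next-inject₁ i) ∘ closed (inject₁ i)
  where
  next-inject₁ : (i : Fin k) → next (inject₁ i) ≡ suc i
  next-inject₁ i rewrite view-inject₁ i = refl

  next-fromℕ : next (fromℕ k) ≡ zero
  next-fromℕ rewrite view-fromℕ k = refl

  q₀ : Q zero
  q₀ = >-weakInduction (λ i → Q i → Q zero)
    (subst Q next-fromℕ ∘ closed (fromℕ k))
    (λ i to₀ → to₀ ∘ subst Q (next-inject₁ i) ∘ closed (inject₁ i)) i q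

module _ {M : Multigraph} where
  open Multigraph M

  -- Going once around the cycle from the head of `a j` to its tail uses every arc but `a j`.
  around : ∀ {A : Arcs M} {k} (a : Fin (suc k) → E × Sign) →
           (∀ i → headₐ {M} (a i) ≈ tailₐ {M} (a (next i))) →
           ∀ j → (∀ i → i ≢ j → uncurry A (a i)) → Route M A (headₐ {M} (a j)) (tailₐ {M} (a j))
  around {A} a chain j allowed =
    next-closed (λ i → Route M A (headₐ {M} (a j)) (tailₐ {M} (a i))) closed (stay (chain j)) j
    where
    closed : ∀ i → Route M A (headₐ {M} (a j)) (tailₐ {M} (a i)) →
             Route M A (headₐ {M} (a j)) (tailₐ {M} (a (next i)))
    closed i r with i Fin.≟ j
    -- Beyond `a j` itself the route begins afresh, since the next tail is the head of `a j`.
    ... | yes refl = stay (chain i)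
    ... | no i≢j   = r ▷ step _ _ (allowed i i≢j) ≈-refl (stay (chain i))

module _ {M : Multigraph} {C : Multigraph.E M → Bool} where
  private
    module M = Multigraph M
    module R = Multigraph (removeIsolated (deleteEdges M C))

  tail-nonisolated : ∀ f ε → value (R.tail f ε) ≡ M.tail (value f) ε
  tail-nonisolated f Sign.+ = refl
  tail-nonisolated f Sign.- = refl

-- Min-edge cycle properties

module CycleProperty (datum : MinEdgeCycleDatum) where
  open MinEdgeCycleDatum datum

  -- m^ε is the arc by which a bad potential cycle with minimum edge m passes
  -- through m.
  Active : (Sign → Bool) → Sign → Set
  Active o ε = X (o Sign.+ , o Sign.-) ≡ true × o ε ≡ true × ((∀ φ → o φ ≡ true) → ε ≡ δ)

  active? : ∀ o ε → Dec (Active o ε)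
  active? o ε = (X _ Bool.≟ true) ×-dec (o ε Bool.≟ true) ×-dec
                (∀-sign? (λ φ → o φ Bool.≟ true) →-dec (ε Sign.≟ δ))

  active-resp : ∀ {o o′ ε} → o ≗ o′ → Active o ε → Active o′ ε
  active-resp eq (x , in-o , bi) =
    trans (sym (cong X (cong₂ _,_ (eq Sign.+) (eq Sign.-)))) x ,
    trans (sym (eq _)) in-o ,
    λ both → bi λ φ → trans (eq φ) (both φ)

  active-unique : ∀ {o ε φ} → Active o ε → Active o φ → ε ≡ φ
  active-unique {ε = Sign.+} {Sign.+} _ _ = refl
  active-unique {ε = Sign.-} {Sign.-} _ _ = refl
  active-unique {ε = Sign.+} {Sign.-} (_ , p , bi) (_ , q , bi′) =
    trans (bi both) (sym (bi′ both))
    where both = λ { Sign.+ → p ; Sign.- → q }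
  active-unique {ε = Sign.-} {Sign.+} (_ , p , bi) (_ , q , bi′) =
    trans (bi both) (sym (bi′ both))
    where both = λ { Sign.+ → q ; Sign.- → p }

  module _ (G : OOGraph) (O : 𝔽 G) where
    open OOGraph G
    open IsStrictTotalOrder isStrictTotalOrder using (_<?_)

    Above : E → Arcs graph
    Above m f φ = O f φ ≡ true × m < f

    above? : ∀ m f φ → Dec (Above m f φ)
    above? m f φ = (O f φ Bool.≟ true) ×-dec (m <? f)

    Obstruction : Arcs graph
    Obstruction m ε = Active (O m) ε × Route graph (Above m) (head m ε) (tail m ε)

    Obstructed : Set
    Obstructed = ∃[ m ] ∃[ ε ] Obstruction m ε

    obstructed? : Dec Obstructed
    obstructed? = ∃-arc? {M = graph} λ m ε →
      active? (O m) ε ×-dec route? (above? m) (head m ε) (tail m ε)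

    -- Constrains the arcs other than `m^ε`; that `m^ε` lies in `O` comes from `Active`.
    MinimumCycle : E → Sign → DirectedCycle G → Set
    MinimumCycle m ε Cy = let open DirectedCycle Cy in
      ∃[ j ] (edge j ≡ m × sign j ≡ ε × (∀ i → i ≢ j → Above m (edge i) (sign i)))

  module _ {G : OOGraph} {O : 𝔽 G} where
    open OOGraph G

    -- The cycle consists of `m^ε`, at index `zero`, and a loop-erased return route. The tail of
    -- `m^ε` is the end of that route and so no tail within it; its edges differ from `m`, being
    -- above it.
    obstruction⇒cycle : ∀ {m ε} → Obstruction G O m ε →
                        ∃[ Cy ] (DirectedCycle.Simple Cy × MinimumCycle G O m ε Cy)
    obstruction⇒cycle {m} {ε} (_ , r₀) = Cy , simple , zero , refl , refl , above
      where
      r = proj₁ (loop-erase r₀)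
      s = proj₂ (loop-erase r₀)
      as = (m , ε) ∷ arcs r

      allowed : All (uncurry (Above G O m)) (arcs r)
      allowed = arcs-allowed r

      all-apart : AllPairs (Apart {graph}) as
      all-apart = All.map (λ (t , _ , m<f) → (λ p → t (≈-sym p)) , λ { refl → <-irrefl refl m<f })
                          (All.zip (tails-before-end r s , allowed)) ∷ arcs-apart r s

      directed : ∀ i → tailₐ {graph} (lookup as i) ≈ tailₐ {graph} (lookup as i) ×
                       headₐ {graph} (lookup as i) ≈ tailₐ {graph} (lookup as (next i))
      directed i = ≈-refl , chain-closed m ε r i

      Cy : DirectedCycle G
      Cy = record
        { cycle = record
          { k-1           = length (arcs r)
          ; vertex        = tailₐ {graph} ∘ lookup as
          ; edge          = proj₁ ∘ lookup as
          ; edge-distinct = λ {i} {j} p → decidable-stable (i Fin.≟ j)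
                              λ i≢j → proj₂ (apart-lookup {M = graph} all-apart i j i≢j) p
          ; joins         = λ i → proj₂ (lookup as i) , directed i
          }
        ; sign     = proj₂ ∘ lookup as
        ; directed = directed
        }

      simple : DirectedCycle.Simple Cy
      simple {i} {j} p = decidable-stable (i Fin.≟ j)
                           λ i≢j → proj₁ (apart-lookup {M = graph} all-apart i j i≢j) p

      above : ∀ i → i ≢ zero → uncurry (Above G O m) (lookup as i)
      above zero    i≢0 = ⊥-elim (i≢0 refl)
      above (suc i) _   = All.lookup allowed (∈-lookup i)

    minimum-cycle-potential : ∀ {m ε Cy} → Active (O m) ε →
                              MinimumCycle G O m ε Cy → PotentialCycle G O Cy
    minimum-cycle-potential (_ , o , _) (j , refl , refl , above) _ _ (i , refl , refl) with i Fin.≟ j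
    ... | yes refl = o
    ... | no i≢j   = proj₁ (above i i≢j)

    minimum-cycle-bad : ∀ {m ε Cy} → Active (O m) ε → MinimumCycle G O m ε Cy → BadCycle datum G O Cy
    minimum-cycle-bad {m} {ε} {Cy} (x , _ , bi) (j , refl , refl , above) =
      m , ((j , refl) , min) , x , λ both → j , refl , bi both
      where
      open DirectedCycle Cy

      min : ∀ f → Edges f → f ≡ m ⊎ m < f
      min _ (i , refl) with i Fin.≟ j
      ... | yes refl = inj₁ refl
      ... | no i≢j   = inj₂ (proj₂ (above i i≢j))

    -- The other arcs of the cycle lie in `O` above the minimum edge and lead from the head of its
    -- arc to the tail.
    bad-cycle⇒obstructed : ∀ {Cy} → PotentialCycle G O Cy → BadCycle datum G O Cy → Obstructed G O
    bad-cycle⇒obstructed {Cy} pot (_ , ((j , refl) , min) , x , bi) =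
      edge j , sign j , (x , pot _ _ (j , refl , refl) , sign-δ) ,
      around (λ i → edge i , sign i) chain j allowed
      where
      open DirectedCycle Cy

      sign-δ : Bioriented G O (edge j) → sign j ≡ δ
      sign-δ both with bi both
      -- The sign given by `bi` sits at an index `i` that carries the same edge as `j`; distinctness
      -- of the edges makes it `j`.
      ... | i , p , q = trans (cong sign (sym (edge-distinct p))) q

      chain : ∀ i → head (edge i) (sign i) ≈ tail (edge (next i)) (sign (next i))
      chain i = ≈-trans (proj₂ (directed i)) (≈-sym (proj₁ (directed (next i))))

      allowed : ∀ i → i ≢ j → Above G O (edge j) (edge i) (sign i)
      allowed i i≢j with min (edge i) (i , refl)
      ... | inj₁ p   = ⊥-elim (i≢j (edge-distinct p))
      ... | inj₂ m<f = pot _ _ (i , refl , refl) , m<f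

  good⇔ : ∀ G O → minEdgeCycle datum G O ⇔ (¬ Obstructed G O)
  good⇔ G O = mk⇔
    (λ good (m , ε , obs) → let Cy , _ , min = obstruction⇒cycle obs in
      good Cy (minimum-cycle-potential {Cy = Cy} (proj₁ obs) min)
              (minimum-cycle-bad {Cy = Cy} (proj₁ obs) min))
    (λ ¬obs Cy pot bad → ¬obs (bad-cycle⇒obstructed {Cy = Cy} pot bad))

  good? : ∀ G O → Dec (minEdgeCycle datum G O)
  good? G O = map′ (Equivalence.from (good⇔ G O)) (Equivalence.to (good⇔ G O)) (¬? (obstructed? G O))

  T1 : ∀ G O → ¬ minEdgeCycle datum G O → ∃[ Cy ] PotentialCycle G O Cy
  T1 G O bad with obstructed? G O
  ... | yes (m , ε , obs) = let Cy , _ , min = obstruction⇒cycle obs in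
                            Cy , minimum-cycle-potential {Cy = Cy} (proj₁ obs) min
  ... | no ¬obs           = ⊥-elim (bad (Equivalence.from (good⇔ G O) ¬obs))

  module _ {G : OOGraph} {O : 𝔽 G} {H : OOGraph} {O′ : 𝔽 H} (iso : Isomorphism G O H O′) where
    private
      module G = OOGraph G
      module H = OOGraph H
    open Isomorphism iso
    open IsomorphismProperties iso

    obstruction-push : ∀ {m ε} → Obstruction G O m ε → Obstruction H O′ (emap m) ε
    obstruction-push {m} {ε} (active , r) = active-resp (O-compat m) active ,
      (prepend (H.≈-sym (tail-compat m (opposite ε))) (route-map above r) ▷ stay (tail-compat m ε))
      where
      above : ∀ {f φ} → Above G O m f φ → Above H O′ (emap m) (emap f) φ
      above (o , m<f) = trans (sym (O-compat _ _)) o , Equivalence.to (order-compat _ _) m<f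

    good-reflect : minEdgeCycle datum H O′ → minEdgeCycle datum G O
    good-reflect good = Equivalence.from (good⇔ G O) λ (m , ε , obs) →
      Equivalence.to (good⇔ H O′) good (emap m , ε , obstruction-push obs)

  isFourientationProperty : IsFourientationProperty (minEdgeCycle datum)
  isFourientationProperty = record
    { good?     = good?
    ; invariant = λ iso → mk⇔ (good-reflect (IsomorphismProperties.inverse-iso iso)) (good-reflect iso)
    }

  private P = minEdgeCycle datum

  -- Restriction to a cycle

  module _ {G : OOGraph} {O : 𝔽 G} where
    open OOGraph G

    -- The minor is a subgraph, so its return routes are return routes of `G`.
    minor-obstructed⇒obstructed : ∀ Cy → Obstructed (cycleMinor G Cy) (restrict G O) → Obstructed G O
    minor-obstructed⇒obstructed Cy (m , ε , active , r) = value m , ε , active ,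
      subst₂ (Route graph _) (tail-nonisolated {C = offCycle G Cy} m (opposite ε))
                             (tail-nonisolated {C = offCycle G Cy} m ε)
        (fold {M = K.graph} (λ u v → Route graph (Above G O (value m)) (value u) (value v)) stay _▷_
          (λ f φ a → subst₂ (Route graph _)
            (sym (tail-nonisolated {C = offCycle G Cy} f φ))
            (sym (tail-nonisolated {C = offCycle G Cy} f (opposite φ)))
            (arc (value f) φ a)) r)
      where module K = OOGraph (cycleMinor G Cy)

    -- All edges of the cycle survive in its minor, where going around it gives the return route
    -- again.
    minimum-cycle⇒minor-obstructed : ∀ {m ε Cy} → Active (O m) ε → MinimumCycle G O m ε Cy →
      Obstructed (cycleMinor G (DirectedCycle.cycle Cy)) (restrict G O)
    minimum-cycle⇒minor-obstructed {Cy = Cy} active (j , refl , refl , above) =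
      edge′ j , sign j , active , around (λ i → edge′ i , sign i) chain j above
      where
      open DirectedCycle Cy
      module K = OOGraph (cycleMinor G cycle)

      edge′ : Fin (suc k-1) → K.E
      edge′ i = edge i ⊣ [ cong not (dec-true (edges? (edge i)) (i , refl)) ]

      tail′ : ∀ i φ → value (K.tail (edge′ i) φ) ≡ tail (edge i) φ
      tail′ i = tail-nonisolated {C = offCycle G cycle} (edge′ i)

      chain : ∀ i → K.head (edge′ i) (sign i) K.≈ K.tail (edge′ (next i)) (sign (next i))
      chain i = subst₂ _≈_ (sym (tail′ i (opposite (sign i)))) (sym (tail′ (next i) (sign (next i))))
        (≈-trans (proj₂ (directed i)) (≈-sym (proj₁ (directed (next i)))))

  isCycleProperty : IsCycleProperty P
  isCycleProperty G O = mk⇔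
    (λ good Cy _ → from (good⇔ _ _) (to (good⇔ G O) good ∘ minor-obstructed⇒obstructed Cy))
    (λ minors-good → from (good⇔ G O) λ (m , ε , obs) →
      no-obstruction minors-good obs (obstruction⇒cycle obs))
    where
    open Equivalence using (to; from)

    no-obstruction : ∀ {m ε} → (∀ Cy → Cycle.Simple Cy → P (cycleMinor G Cy) (restrict G O)) →
                     Obstruction G O m ε →
             ¬ (∃[ Cy ] (DirectedCycle.Simple Cy × MinimumCycle G O m ε Cy))
    no-obstruction minors-good (active , _) (Cy , simple , min) =
      to (good⇔ _ _) (minors-good (DirectedCycle.cycle Cy) simple)
                     (minimum-cycle⇒minor-obstructed {Cy = Cy} active min)

  -- T2 for cycles: the maximum edge is contracted

  module _ (G : OOGraph) {e : OOGraph.E G} (e-max : IsMaximum (OOGraph.graph G) e)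
           (¬loop : ¬ IsLoop (OOGraph.graph G) e) (O : 𝔽 (contract G e)) where
    open OOGraph G
    private
      K = contract G e
      module K = OOGraph K

    O₀ : 𝔽 G
    O₀ = extend G O

    Target : Arcs graph
    Target m ε = m ≢ e × Active (O₀ m) ε

    below-max : ∀ {m} → m ≢ e → m < e
    below-max {m} m≢e = [ (λ m≡e → ⊥-elim (m≢e m≡e)) , id ]′ (e-max m)

    nothing-above : ∀ {f} → ¬ e < f
    nothing-above {f} e<f with e-max f
    ... | inj₁ refl = <-irrefl refl e<f
    ... | inj₂ f<e  = <-irrefl refl (<-trans f<e e<f)

    -- No edge lies above `e`, so the route has no arcs and `e` would be a loop.
    max-never-returns : ∀ {O′} ε → ¬ Route graph (Above G O′ e) (head e ε) (tail e ε)
    max-never-returns ε r = ¬loop (loop ε (fold _≈_ id ≈-trans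
      (λ _ _ (_ , e<f) → ⊥-elim (nothing-above e<f)) r))
      where
      loop : ∀ ε → head e ε ≈ tail e ε → src e ≈ tgt e
      loop Sign.+ = ≈-sym
      loop Sign.- = id

    -- Every other edge lies below `e`, so the added arcs of `e` are available to the return routes
    -- of all of them.
    obstructed⇔linked : ∀ {S O′} → Adds G O₀ e S O′ →
                        Obstructed G O′ ⇔ Linked graph e Target (Above G O₀) S
    obstructed⇔linked {S} {O′} adds = mk⇔
      (λ (m , ε , active , r) →
        let m≢e = λ { refl → max-never-returns {O′} ε r } in
        m , ε , (m≢e , active-resp (sym ∘ adds-elsewhere G adds m≢e) active) , mono from′ r)
      (λ (m , ε , (m≢e , active) , r) →
        m , ε , active-resp (adds-elsewhere G adds m≢e) active , mono (to′ (below-max m≢e)) r)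
      where
      open Equivalence using (to; from)

      to′ : ∀ {m f φ} → m < e → Above G O₀ m f φ ⊎ (f ≡ e × S φ) → Above G O′ m f φ
      to′ m<e (inj₁ (o , m<f))     = from (adds _ _) (inj₁ o) , m<f
      to′ m<e (inj₂ s@(refl , _)) = from (adds _ _) (inj₂ s) , m<e

      from′ : ∀ {m f φ} → Above G O′ m f φ → Above G O₀ m f φ ⊎ (f ≡ e × S φ)
      from′ (o , m<f) = [ (λ o → inj₁ (o , m<f)) , inj₂ ]′ (to (adds _ _) o)

    -- Identifying the ends of `e` has the same effect on reachability as allowing `e` in both
    -- directions.
    contract-obstructed⇔linked : Obstructed K O ⇔ Linked graph e Target (Above G O₀) (λ _ → ⊤)
    contract-obstructed⇔linked = mk⇔
      (λ (m , ε , active , r) →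
        value m , ε ,
        (only-false⁻ G (value-outside G m) , active-resp (sym ∘ extend-value G O m) active) ,
        subst₂ (Route graph _) (tail-contracted m (opposite ε)) (tail-contracted m ε) (up {m} r))
      (λ (m , ε , (m≢e , active) , r) →
        let m′ = m ⊣ [ only-false G m≢e ] in
        m′ , ε , active-resp (extend-value G O m′) active ,
        subst₂ (Route K.graph _)
          (sym (tail-contracted m′ (opposite ε))) (sym (tail-contracted m′ ε)) (down {m′} r))
      where
      up : ∀ {m u v} → Route K.graph (Above K O m) u v →
           Route graph (λ f φ → Above G O₀ (value m) f φ ⊎ (f ≡ e × ⊤)) u v
      up = fold {M = K.graph} (Route graph _)
        (along-edges (λ s _ → inj₂ (only-true G s , tt))) _▷_ λ f φ (o , m<f) →
        subst₂ (Route graph _) (sym (tail-contracted f φ)) (sym (tail-contracted f (opposite φ)))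
          (arc (value f) φ (inj₁ (trans (extend-value G O f φ) o , m<f)))

      down : ∀ {m u v} → Route graph (λ f φ → Above G O₀ (value m) f φ ⊎ (f ≡ e × ⊤)) u v →
             Route K.graph (Above K O m) u v
      down {m} = fold {M = graph} (Route K.graph _) (λ p → stay (stay p)) _▷_ λ where
          f φ (inj₂ (refl , _)) → stay (along e φ (only-self G e))
          f φ (inj₁ (o , m<f))  → kept f φ (only-false G (extend-oriented G O o)) o m<f
        where
        kept : ∀ f φ (p : only G e f ≡ false) → O₀ f φ ≡ true → value m < f →
               Route K.graph (Above K O m) (tail f φ) (head f φ)
        kept f φ p o m<f = subst₂ (Route K.graph _)
                             (tail-contracted f′ φ) (tail-contracted f′ (opposite φ))
                             (arc f′ φ (trans (sym (extend-outside G O p φ)) o , m<f))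
          where
          f′ : K.E
          f′ = f ⊣ [ p ]

    comparable : ∀ {m ε m′ ε′} → Target m ε → Target m′ ε′ →
                 (m ≡ m′ × ε ≡ ε′) ⊎ Dominated graph e Target (Above G O₀) m ε m′
                                   ⊎ Dominated graph e Target (Above G O₀) m′ ε′ m
    comparable {m} {_} {m′} (_ , active) (_ , active′) with compare m m′
    ... | tri≈ _ refl _ = inj₁ (refl , active-unique active active′)
    ... | tri> _ _ m′<m =
      inj₂ (inj₁ ((λ (o , m<f) → o , <-trans m′<m m<f) , proj₁ (proj₂ active) , m′<m))
    ... | tri< m<m′ _ _ =
      inj₂ (inj₂ ((λ (o , m′<f) → o , <-trans m<m′ m′<f) , proj₁ (proj₂ active′) , m<m′))

    cycleT2 : CycleT2 P G e O
    cycleT2 = record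
      -- A return route that uses `e` in one direction only also exists when both are allowed.
      { a = λ good → let ok = to contracted good in
              from unlinked₊ (λ (m , ε , t , r) → ok (m , ε , t , mono forget r))
            , from unlinked₋ (λ (m , ε , t , r) → ok (m , ε , t , mono forget r))
      ; b = λ bad good →
          [ (λ (g , b) → inj₁ (from unlinked₊ g , b ∘ to unlinked₋))
          , (λ (b , g) → inj₂ (b ∘ to unlinked₊ , from unlinked₋ g)) ]′
          (linked-exactly-one graph e Target (Above G O₀) comparable
            (bad ∘ from contracted) (to (unlinked (adds-none G)) good)
            (map′ (to unlinked₊) (from unlinked₊) (good? G _))
            (map′ (to unlinked₋) (from unlinked₋) (good? G _)))
      ; c = mk⇔ (from (unlinked (adds-both G)) ∘ to contracted)
                (from contracted ∘ to (unlinked (adds-both G)))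
      }
      where
      open Equivalence using (to; from)

      unlinked : ∀ {S O′} → Adds G O₀ e S O′ → P G O′ ⇔ (¬ Linked graph e Target (Above G O₀) S)
      unlinked adds = mk⇔ (λ good → to (good⇔ _ _) good ∘ from (obstructed⇔linked adds))
                          (λ ok → from (good⇔ _ _) (ok ∘ to (obstructed⇔linked adds)))

      unlinked₊ = unlinked (adds-one G Sign.+)
      unlinked₋ = unlinked (adds-one G Sign.-)

      contracted : P K O ⇔ (¬ Linked graph e Target (Above G O₀) (λ _ → ⊤))
      contracted = mk⇔ (λ good → to (good⇔ _ _) good ∘ from contract-obstructed⇔linked)
                       (λ ok → from (good⇔ _ _) (ok ∘ to contract-obstructed⇔linked))

      forget : ∀ {A B C : Set} → A ⊎ (B × C) → A ⊎ (B × ⊤)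
      forget = [ inj₁ , (λ (b , _) → inj₂ (b , tt)) ]′

  isTutteCycleProperty : IsTutteCycleProperty P
  isTutteCycleProperty = record
    { isFourientationProperty = isFourientationProperty
    ; isCycleProperty         = isCycleProperty
    ; T1                      = T1
    ; T2                      = λ G e e-max _ ¬loop O → cycleT2 G e-max ¬loop O
    }

theorem2p16 : ((datum : MinEdgeCutDatum) → IsTutteCutProperty (minEdgeCut datum))
    × ((datum : MinEdgeCycleDatum) → IsTutteCycleProperty (minEdgeCycle datum))
theorem2p16 = CutProperty.isTutteCutProperty , CycleProperty.isTutteCycleProperty
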